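{- Let $r\geq 2$ and $d\geq 2$ be integers, let $\mathbf a=(a_1,\ldots,a_r)$ be a sequence of positive integers, and let $D(d)=\operatorname{lcm}(da_1,\ldots,da_r)$. For an integer $n\geq 0$ let $\mathbf p_{\mathbf a,d}(n)$ denote the number of integer tuples $(x_1,\ldots,x_r)$ with $\sum_{i=1}^r a_ix_i=n$, $x_i\geq 0$ and $x_i\equiv 0$ or $x_i\equiv 1\pmod d$ for all $i$. Then for all $n\geq 0$, $$\mathbf p_{\mathbf a,d}(n)=\frac{1}{(r-1)!}\sum_{\varepsilon\in\{0,1\}^r}\ \sum_{\substack{0\leq j_i\leq \frac{D(d)}{da_i}-1,\ 1\leq i\leq r\\ \sum_{i=1}^r a_i(dj_i+\varepsilon_i)\equiv n \pmod{D(d)}}}\ \prod_{\ell=1}^{r-1}\left(\frac{n-\sum_{i=1}^r a_i(dj_i+\varepsilon_i)}{D(d)}+\ell\right),$$ where $\varepsilon=(\varepsilon_1,\ldots,\varepsilon_r)$. Moreover, the polynomial part of $\mathbf p_{\mathbf a,d}$ is $$P_{\mathbf a,d}(n)=\frac{1}{D(d)(r-1)!}\sum_{\substack{\varepsilon\in\{0,1\}^r\\ 0\leq j_i\leq \frac{D(d)}{da_i}-1,\ 1\leq i\leq r}}\ \prod_{\ell=1}^{r-1}\left(\frac{n-\sum_{i=1}^r a_i(dj_i+\varepsilon_i)}{D(d)}+\ell\right).$$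
   Context: The polynomial part $P_{\mathbf a,d}(n)$ of $\mathbf p_{\mathbf a,d}$ is the polynomial in $n$ given by the coefficient of $t^{ -1}$ in the Laurent expansion at $t=0$ of $e^{nt}\prod_{i=1}^r\dfrac{1+e^{ -a_it}}{1-e^{ -da_it}}$ (equivalently, the sum over $J\subseteq\{1,\ldots,r\}$ of Sylvester's first waves $P_{d\mathbf a}(n-\sum_{i\in J}a_i)$ of the restricted partition function with parts $da_1,\ldots,da_r$). -}

module Defs where

open import Data.Integer as ℤ using (ℤ; +_; -[1+_])
open import Data.Fin using (Fin; zero; suc)
open import Data.List using (List; []; _∷_; upTo; filter; length; foldr; map; cartesianProductWith)
open import Data.List.Membership.Propositional using (_∈_)
open import Data.List.Membership.Propositional.Properties
  using (∈-cartesianProductWith⁺; ∈-cartesianProductWith⁻; ∈-upTo⁺; ∈-upTo⁻; ∈-filter⁺; ∈-filter⁻)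
open import Data.List.Relation.Unary.Any using (here)
import Data.List.Relation.Unary.AllPairs as AllPairs
import Data.List.Relation.Unary.All as ListAll
open import Data.List.Relation.Unary.Unique.Propositional using (Unique)
import Data.List.Relation.Unary.Unique.Propositional.Properties as Uniq
open import Data.Nat as ℕ using (ℕ; zero; suc; _∸_; _<_; _≤_; NonZero; ∣_-_∣; _!; s≤s)
open import Data.Nat.Divisibility using (_∣_; _∣?_)
open import Data.Nat.GCD using (gcd)
open import Data.Nat.LCM using (lcm; gcd*lcm)
import Data.Nat.Properties as ℕ
open import Data.Product using (_×_; _,_; proj₂)
open import Data.Rational using (ℚ; 0ℚ; 1ℚ; _+_; _*_; _-_; -_; _/_; 1/_)
  renaming (NonZero to NonZeroℚ)
import Data.Rational.Properties as ℚ
open import Data.Sum using (_⊎_)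
open import Data.Vec as Vec using (Vec; []; _∷_; lookup; zipWith; replicate; tabulate)
open import Data.Vec.Properties using (∷-injective)
open import Data.Vec.Relation.Unary.All using (All; all?)
open import Data.Vec.Relation.Binary.Pointwise.Inductive using (Pointwise; []; _∷_)
open import Algebra.Bundles using (CommutativeRing)
open import Algebra.Properties.Semiring.Exp (CommutativeRing.semiring ℚ.+-*-commutativeRing)
  using (_^_) public
open import Relation.Nullary using (Dec)
open import Relation.Nullary.Decidable using (_×-dec_; _⊎-dec_)
open import Relation.Binary.PropositionalEquality using (_≡_; refl; sym; trans; cong; subst)

fromℕ : ℕ → ℚ
fromℕ n = + n / 1

infixl 7 _÷ℕ_
_÷ℕ_ : ℚ → (m : ℕ) → .{{NonZero m}} → ℚ
q ÷ℕ m = q * (+ 1 / m)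

∑ : {A : Set} → List A → (A → ℚ) → ℚ
∑ xs f = foldr _+_ 0ℚ (map f xs)

∏ : {A : Set} → List A → (A → ℚ) → ℚ
∏ xs f = foldr _*_ 1ℚ (map f xs)

infix 5 ∑ ∏
syntax ∑ xs (λ x → e) = ∑[ x ← xs ] e
syntax ∏ xs (λ x → e) = ∏[ x ← xs ] e

infix 4 _≡_[mod_] _≡?_[mod_]

_≡_[mod_] : ℕ → ℕ → ℕ → Set
x ≡ y [mod m ] = m ∣ ∣ x - y ∣

_≡?_[mod_] : ∀ x y m → Dec (x ≡ y [mod m ])
x ≡? y [mod m ] = m ∣? ∣ x - y ∣

infix 8 _∙_
_∙_ : ∀ {r} → Vec ℕ r → Vec ℕ r → ℕ
a ∙ x = Vec.sum (zipWith ℕ._*_ a x)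

-- All x ∈ ℕʳ with xᵢ < bᵢ for every i, each listed once.
box : ∀ {r} → Vec ℕ r → List (Vec ℕ r)
box []      = [] ∷ []
box (b ∷ bs) = cartesianProductWith _∷_ (upTo b) (box bs)

∈-box⁺ : ∀ {r} {x b : Vec ℕ r} → Pointwise _<_ x b → x ∈ box b
∈-box⁺ []       = here refl
∈-box⁺ (p ∷ ps) = ∈-cartesianProductWith⁺ _∷_ (∈-upTo⁺ p) (∈-box⁺ ps)

∈-box⁻ : ∀ {r} {x b : Vec ℕ r} → x ∈ box b → Pointwise _<_ x b
∈-box⁻ {b = []} (here refl) = []
∈-box⁻ {b = b ∷ bs} m with ∈-cartesianProductWith⁻ _∷_ (upTo b) (box bs) m
... | _ , _ , y∈ , ys∈ , refl = ∈-upTo⁻ y∈ ∷ ∈-box⁻ ys∈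

box-unique : ∀ {r} (b : Vec ℕ r) → Unique (box b)
box-unique []       = ListAll.[] AllPairs.∷ AllPairs.[]
box-unique (b ∷ bs) =
  Uniq.cartesianProductWith⁺ _∷_ ∷-injective (Uniq.upTo⁺ b) (box-unique bs)

-- Formal power series ∑ₖ f(k) tᵏ over ℚ.
Series : Set
Series = ℕ → ℚ

infixl 7 _⊛_
_⊛_ : Series → Series → Series
(f ⊛ g) n = ∑[ k ← upTo (suc n) ] (f k * g (n ∸ k))

1ˢ : Series
1ˢ zero    = 1ℚ
1ˢ (suc _) = 0ℚ

-- e^{ct}
exp : ℚ → Series
exp c k = ((c ^ k) ÷ℕ (k !)) {{k ℕ.!≢0}}

-- The coefficients gₙ , … , g₀ of g = 1/f, by g₀ = 1/f₀ and
-- gₙ₊₁ = -(1/f₀) ∑_{i ≤ n} fᵢ₊₁ gₙ₋ᵢ.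
recipCoeffs : (f : Series) → .{{NonZeroℚ (f 0)}} → (n : ℕ) → Vec ℚ (suc n)
recipCoeffs f zero    = 1/ f 0 ∷ []
recipCoeffs f (suc n) = - (1/ f 0) * conv 1 g ∷ g
  where
  g = recipCoeffs f n
  conv : ∀ {m} → ℕ → Vec ℚ m → ℚ
  conv _ []       = 0ℚ
  conv i (q ∷ qs) = f i * q + conv (suc i) qs

recip : (f : Series) → .{{NonZeroℚ (f 0)}} → Series
recip f n = Vec.head (recipCoeffs f n)

-- The formal Laurent series t^{-pole} · series.  The coefficient
-- series(0) is allowed to vanish, so pole only bounds the order of the pole.
record Laurent : Set where
  constructor t^-_·_
  field
    pole   : ℕ
    series : Series

open Laurent public

coeff : Laurent → ℤ → ℚ
coeff L m with m ℤ.+ + pole L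
... | + k      = series L k
... | -[1+ _ ] = 0ℚ

↑_ : Series → Laurent
↑ f = t^- 0 · f

infixl 7 _⊠_
_⊠_ : Laurent → Laurent → Laurent
K ⊠ L = t^- (pole K ℕ.+ pole L) · (series K ⊛ series L)

-- 1 / f for a series f with a simple zero at t = 0: writing f = t u with
-- u(0) ≠ 0, it is t⁻¹ (1 / u).
1/simpleZero : (f : Series) → f 0 ≡ 0ℚ → .{{NonZeroℚ (f 1)}} → Laurent
1/simpleZero f _ = t^- 1 · recip (λ k → f (suc k))

1+exp- : ℕ → Series
1+exp- c k = 1ˢ k + exp (- fromℕ c) k

1-exp- : ℕ → Series
1-exp- c k = 1ˢ k - exp (- fromℕ c) k

1-exp-₁ : ∀ c → 1-exp- c 1 ≡ fromℕ c
1-exp-₁ c = trans (ℚ.+-identityˡ _)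
  (trans (cong -_ (trans (ℚ.*-identityʳ _) (ℚ.*-identityʳ _))) (neg-neg (fromℕ c)))
  where
  open import Algebra.Properties.Group ℚ.+-0-group using () renaming (⁻¹-involutive to neg-neg)

1-exp-₁≢0 : ∀ c → .{{NonZero c}} → NonZeroℚ (1-exp- c 1)
1-exp-₁≢0 c = subst NonZeroℚ (sym (1-exp-₁ c))
  (ℚ.pos⇒nonZero (fromℕ c) {{ℚ.normalize-pos c 1}})

module RestrictedPartition {r : ℕ} (d : ℕ) (a : Vec ℕ r)
  (0<d : 0 < d) (0<a : ∀ i → 0 < lookup a i) where

  Admissible : ℕ → Vec ℕ r → Set
  Admissible n x = a ∙ x ≡ n × All (λ y → y ≡ 0 [mod d ] ⊎ y ≡ 1 [mod d ]) x

  admissible? : ∀ n x → Dec (Admissible n x)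
  admissible? n x =
    (a ∙ x ℕ.≟ n) ×-dec all? (λ y → (y ≡? 0 [mod d ]) ⊎-dec (y ≡? 1 [mod d ])) x

  -- Since aᵢ ≥ 1, every solution has xᵢ ≤ n, so no solution is lost by
  -- searching the box; see ∈-solutions⁺, ∈-solutions⁻ and solutions-unique.
  solutions : ℕ → List (Vec ℕ r)
  solutions n = filter (admissible? n) (box (replicate r (suc n)))

  p : ℕ → ℕ
  p n = length (solutions n)

  D : ℕ
  D = Vec.foldr′ lcm 1 (Vec.map (d ℕ.*_) a)

  D≢0 : NonZero D
  D≢0 = go a 0<a
    where
    go : ∀ {s} (b : Vec ℕ s) → (∀ i → 0 < lookup b i) →
         NonZero (Vec.foldr′ lcm 1 (Vec.map (d ℕ.*_) b))
    go []      _   = _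
    go (x ∷ b) 0<b = ℕ.≢-nonZero λ lcm≡0 →
      ℕ.≢-nonZero⁻¹ (d ℕ.* x ℕ.* m) (trans (sym (gcd*lcm (d ℕ.* x) m))
        (trans (cong (gcd (d ℕ.* x) m ℕ.*_) lcm≡0) (ℕ.*-zeroʳ (gcd (d ℕ.* x) m))))
      where
      m = Vec.foldr′ lcm 1 (Vec.map (d ℕ.*_) b)
      instance
        _ = ℕ.m*n≢0 (d ℕ.* x) m
              {{ℕ.m*n≢0 d x {{ℕ.>-nonZero 0<d}} {{ℕ.>-nonZero (0<b zero)}}}}
              {{go b (λ i → 0<b (suc i))}}

  d*a≢0 : ∀ i → NonZero (d ℕ.* lookup a i)
  d*a≢0 i = ℕ.m*n≢0 d (lookup a i) {{ℕ.>-nonZero 0<d}} {{ℕ.>-nonZero (0<a i)}}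

  -- The j with 0 ≤ jᵢ ≤ D / (d aᵢ) - 1 are exactly those in box jBound.
  jBound : Vec ℕ r
  jBound = tabulate λ i → (D ℕ./ (d ℕ.* lookup a i)) {{d*a≢0 i}}

  -- ∑ᵢ aᵢ (d jᵢ + εᵢ)
  weight : Vec ℕ r → Vec ℕ r → ℕ
  weight ε j = a ∙ zipWith (λ jᵢ εᵢ → d ℕ.* jᵢ ℕ.+ εᵢ) j ε

  -- (1 + e^{-aᵢ t}) / (1 - e^{-d aᵢ t})
  factor : Fin r → Laurent
  factor i = ↑ 1+exp- (lookup a i)
           ⊠ 1/simpleZero (1-exp- (d ℕ.* lookup a i)) refl
               {{1-exp-₁≢0 (d ℕ.* lookup a i) {{d*a≢0 i}}}}

  generating : ℚ → Laurent
  generating x = ↑ exp x ⊠ Vec.foldr′ _⊠_ (↑ 1ˢ) (tabulate factor)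

  -- The polynomial part, as a polynomial function on ℚ.
  P : ℚ → ℚ
  P x = coeff (generating x) -[1+ 0 ]

  solutions-unique : ∀ n → Unique (solutions n)
  solutions-unique n = Uniq.filter⁺ (admissible? n) (box-unique (replicate r (suc n)))

  ∈-solutions⁻ : ∀ {n x} → x ∈ solutions n → Admissible n x
  ∈-solutions⁻ {n} m = proj₂ (∈-filter⁻ (admissible? n) {xs = box (replicate r (suc n))} m)

  ∈-solutions⁺ : ∀ {n x} → Admissible n x → x ∈ solutions n
  ∈-solutions⁺ {n} {x} adm@(eq , _) =
    ∈-filter⁺ (admissible? n) (∈-box⁺ (bounded a 0<a x (ℕ.≤-reflexive eq))) adm
    where
    bounded : ∀ {s} (b : Vec ℕ s) → (∀ i → 0 < lookup b i) → (y : Vec ℕ s) →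
              b ∙ y ≤ n → Pointwise _<_ y (replicate s (suc n))
    bounded []      _   []      _ = []
    bounded (c ∷ b) 0<b (z ∷ y) h =
      s≤s (ℕ.≤-trans (ℕ.m≤n*m z c {{ℕ.>-nonZero (0<b zero)}})
             (ℕ.≤-trans (ℕ.m≤m+n (c ℕ.* z) (b ∙ y)) h))
      ∷ bounded b (λ i → 0<b (suc i)) y (ℕ.≤-trans (ℕ.m≤n+m (b ∙ y) (c ℕ.* z)) h)

{-# OPTIONS --safe #-}

-- With q = t for p and q = e^{-t} for the polynomial part, both claims concern
-- ∏ᵢ (1 + q^{aᵢ}) / (1 - q^{d aᵢ}).  Since d aᵢ divides D, 1 / (1 - q^{d aᵢ}) is a
-- finite geometric sum over 1 - q^D, so the product is ∑ q^{weight ε j} / (1 - q^D)^r,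
-- summed over ε and j.  For fixed y, let hₖ be the residue at 0 of
-- e^{yt} / (1 - e^{-Dt})^k, or the coefficient of t^n in t^w / (1 - t^D)^k with
-- y = n - w.  Applying t d/dt to these series gives k D hₖ₊₁ = (y + k D) hₖ, which
-- unfolds to the products in the theorem.
module Submission where

open import Defs hiding (_^_)
open import Algebra.Bundles using (CommutativeRing)
import Algebra.Properties.CommutativeMonoid.Sum
import Algebra.Properties.Semiring.Exp
import Algebra.Solver.Ring
open import Algebra.Solver.Ring.AlmostCommutativeRing
  using (fromCommutativeRing; _-Raw-AlmostCommutative⟶_)
open import Data.Bool using (if_then_else_)
open import Data.Fin using (Fin; zero; suc)
open import Data.Integer as ℤ using (+_; -[1+_])
import Data.Integer.Properties as ℤ
open import Data.List as List
  using (List; []; _∷_; _++_; _∷ʳ_; applyUpTo; cartesianProductWith; filter; foldr; map; upTo)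
open import Data.List.Membership.Propositional using (_∈_)
open import Data.List.Membership.Propositional.Properties using (∈-applyUpTo⁺; ∈-upTo⁻)
open import Data.List.Properties using (applyUpTo-∷ʳ; map-applyUpTo)
open import Data.List.Relation.Unary.Any using (here; there)
open import Data.Maybe using (Maybe; just; nothing)
open import Data.Nat as ℕ using (ℕ; zero; suc; _∸_; _!; ∣_-_∣; NonZero; s≤s; z≤n)
open import Data.Nat.DivMod using (m*[n/m]≡n)
open import Data.Nat.Divisibility
  using (_∣_; _∣?_; _∣0; divides; >⇒∤; ∣-refl; ∣-trans; ∣m+n∣m⇒∣n; ∣m∣n⇒∣m+n)
open import Data.Nat.LCM using (lcm; m∣lcm[m,n]; n∣lcm[m,n])
import Data.Nat.Properties as ℕ
open import Data.Nat.Properties using (_!≢0; m*n≢0; <⇒≤)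
import Data.Nat.Solver
open import Data.Product using (_×_; _,_; proj₁; proj₂)
open import Data.Rational as ℚ using (ℚ; 0ℚ; 1ℚ; _+_; _*_; _-_; -_; _/_; 1/_)
  renaming (NonZero to NonZeroℚ)
import Data.Rational.Properties as ℚ
open import Data.Rational.Solver using (module +-*-Solver)
import Data.Rational.Unnormalised as ℚᵘ
import Data.Rational.Unnormalised.Properties as ℚᵘ
open import Data.Sum using (_⊎_; inj₁; inj₂)
open import Data.Vec as Vec using (Vec; []; _∷_; lookup; replicate; tabulate; zipWith)
open import Data.Vec.Properties using (lookup-replicate; lookup-zipWith; lookup∘tabulate)
import Data.Vec.Relation.Binary.Pointwise.Inductive as Pointwise
open import Data.Vec.Relation.Unary.All using (_∷_; all?)
open import Function using (_∘_; id)
open import Level using (0ℓ)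
open import Relation.Binary.PropositionalEquality
  using (_≡_; refl; sym; trans; cong; cong₂; subst; module ≡-Reasoning)
import Relation.Binary.Reasoning.Setoid as SetoidReasoning
open import Relation.Nullary using (Dec; yes; no; does; ¬_; contradiction)
open import Relation.Nullary.Decidable using (_⊎-dec_)
open import Relation.Unary using (Decidable)

-- The ring of formal power series

-- The recursion links hₖ₊₁ to hₖ from k = 1 on, so the two claims differ in h₁ alone. For the
-- polynomial part h₁ = 1 / D for every ε and j, whence the extra 1 / D and an unrestricted sum. For
-- the count h₁ is 1 if w ≤ n and D divides n - w, and 0 otherwise; this is the origin of the
-- congruence. The formula has no condition w ≤ n, so terms with w > n must vanish by themselves: if
-- w - n = q D, then 1 ≤ q ≤ r - 1 because all weights lie below r D, and the factor ℓ = q is zero.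
-- Two obstacles shape the rest. The series 1 - e^(-ct) has constant term 0 and hence no reciprocal,
-- so the work is done with t / (1 - e^(-ct)), and the residue of a k-th power becomes a coefficient
-- of index k - 1. And `p n` counts in a box that depends on n, so its generating function appears
-- as a product of polynomials that are correct only up to degree n.

fromℕ-homo-+ : ∀ m n → fromℕ (m ℕ.+ n) ≡ fromℕ m + fromℕ n
fromℕ-homo-+ m n = ℚ.toℚᵘ-injective (begin
  ℚ.toℚᵘ (fromℕ (m ℕ.+ n))             ≈⟨ ℚ.toℚᵘ-fromℚᵘ (ℚᵘ.mkℚᵘ (+ (m ℕ.+ n)) 0) ⟩
  ℚᵘ.mkℚᵘ (+ (m ℕ.+ n)) 0              ≈⟨ ℚᵘ.*≡* (cong (ℤ._* + 1) (cong₂ ℤ._+_ (sym (ℤ.*-identityʳ (+ m))) (sym (ℤ.*-identityʳ (+ n))))) ⟩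
  ℚᵘ.mkℚᵘ (+ m) 0 ℚᵘ.+ ℚᵘ.mkℚᵘ (+ n) 0 ≈⟨ ℚᵘ.+-cong (ℚ.toℚᵘ-fromℚᵘ (ℚᵘ.mkℚᵘ (+ m) 0)) (ℚ.toℚᵘ-fromℚᵘ (ℚᵘ.mkℚᵘ (+ n) 0)) ⟨
  ℚ.toℚᵘ (fromℕ m) ℚᵘ.+ ℚ.toℚᵘ (fromℕ n) ≈⟨ ℚ.toℚᵘ-homo-+ (fromℕ m) (fromℕ n) ⟨
  ℚ.toℚᵘ (fromℕ m + fromℕ n)           ∎)
  where open import Relation.Binary.Reasoning.Setoid ℚᵘ.≃-setoid

fromℕ-homo-* : ∀ m n → fromℕ (m ℕ.* n) ≡ fromℕ m * fromℕ n
fromℕ-homo-* zero    n = sym (ℚ.*-zeroˡ (fromℕ n))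
fromℕ-homo-* (suc m) n = begin
  fromℕ (n ℕ.+ m ℕ.* n)          ≡⟨ fromℕ-homo-+ n (m ℕ.* n) ⟩
  fromℕ n + fromℕ (m ℕ.* n)      ≡⟨ cong (λ q → fromℕ n + q) (fromℕ-homo-* m n) ⟩
  fromℕ n + fromℕ m * fromℕ n    ≡⟨ solve 2 (λ x y → y :+ x :* y := (con 1ℚ :+ x) :* y) refl (fromℕ m) (fromℕ n) ⟩
  (1ℚ + fromℕ m) * fromℕ n       ≡⟨ cong (_* fromℕ n) (fromℕ-homo-+ 1 m) ⟨
  fromℕ (suc m) * fromℕ n        ∎
  where
  open ≡-Reasoning
  open +-*-Solver

1÷-inverseˡ : ∀ m .{{_ : NonZero m}} → (+ 1 / m) * fromℕ m ≡ 1ℚ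
1÷-inverseˡ (suc m) = ℚ.toℚᵘ-injective (begin
  ℚ.toℚᵘ ((+ 1 / suc m) * fromℕ (suc m))           ≈⟨ ℚ.toℚᵘ-homo-* (+ 1 / suc m) (fromℕ (suc m)) ⟩
  ℚ.toℚᵘ (+ 1 / suc m) ℚᵘ.* ℚ.toℚᵘ (fromℕ (suc m)) ≈⟨ ℚᵘ.*-cong (ℚ.toℚᵘ-fromℚᵘ (ℚᵘ.mkℚᵘ (+ 1) m)) (ℚ.toℚᵘ-fromℚᵘ (ℚᵘ.mkℚᵘ (+ suc m) 0)) ⟩
  ℚᵘ.mkℚᵘ (+ 1) m ℚᵘ.* ℚᵘ.mkℚᵘ (+ suc m) 0         ≈⟨ ℚᵘ.*≡* (trans (ℤ.*-identityʳ _) (cong (λ k → + k) (cong suc (trans (ℕ.+-identityʳ m) (sym (trans (ℕ.+-identityʳ (m ℕ.* 1)) (ℕ.*-identityʳ m))))))) ⟩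
  ℚᵘ.1ℚᵘ                                           ∎)
  where open import Relation.Binary.Reasoning.Setoid ℚᵘ.≃-setoid

-- This stands in for division: an identity with denominators is multiplied out first, and what
-- remains is polynomial.
fromℕ-cancelˡ : ∀ m .{{_ : NonZero m}} {p q} → fromℕ m * p ≡ fromℕ m * q → p ≡ q
fromℕ-cancelˡ m {p} {q} eq = trans (sym (undo p)) (trans (cong ((+ 1 / m) *_) eq) (undo q))
  where
  undo : ∀ p → (+ 1 / m) * (fromℕ m * p) ≡ p
  undo p = trans (sym (ℚ.*-assoc (+ 1 / m) (fromℕ m) p))
    (trans (cong (_* p) (1÷-inverseˡ m)) (ℚ.*-identityˡ p))

infixl 6 _⊕_
infix 8 ⊖_
infix 4 _≈_

_⊕_ : Series → Series → Series
(f ⊕ g) n = f n + g n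

⊖_ : Series → Series
(⊖ f) n = - f n

0ˢ : Series
0ˢ _ = 0ℚ

-- As a record type, `_≈_` is injective for unification, so both series can be read off from the
-- type of a proof; a bare pointwise equality would unfold.
record _≈_ (f g : Series) : Set where
  constructor pointwise
  field at : ∀ n → f n ≡ g n

open _≈_

-- Splitting off the first summand shifts the left factor and keeps the right one, so the ring laws
-- become inductions on the index. The two uses of `map-applyUpTo` move the shift from the list of
-- indices into the summand.
⊛-suc : ∀ f g n → (f ⊛ g) (suc n) ≡ f 0 * g (suc n) + ((f ∘ suc) ⊛ g) n
⊛-suc f g n = cong (λ xs → f 0 * g (suc n) + foldr _+_ 0ℚ xs)
  (trans (map-applyUpTo suc (λ k → f k * g (suc n ∸ k)) (suc n))
    (sym (map-applyUpTo id (λ k → f (suc k) * g (n ∸ k)) (suc n))))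

⊛-zero : ∀ f g → (f ⊛ g) 0 ≡ f 0 * g 0
⊛-zero f g = ℚ.+-identityʳ (f 0 * g 0)

-- Besides giving congruence, this later allows a factor to be replaced by one that agrees with it
-- only in low degrees.
⊛-local : ∀ {f f′ g g′} n → (∀ k → k ℕ.≤ n → f k ≡ f′ k) → (∀ k → k ℕ.≤ n → g k ≡ g′ k) →
          (f ⊛ g) n ≡ (f′ ⊛ g′) n
⊛-local {f} {f′} {g} {g′} zero p q = cong₂ (λ x y → x * y + 0ℚ) (p 0 z≤n) (q 0 z≤n)
⊛-local {f} {f′} {g} {g′} (suc n) p q = begin
  (f ⊛ g) (suc n)                            ≡⟨ ⊛-suc f g n ⟩
  f 0 * g (suc n) + ((f ∘ suc) ⊛ g) n        ≡⟨ cong₂ _+_ (cong₂ _*_ (p 0 z≤n) (q (suc n) ℕ.≤-refl))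
                                                  (⊛-local n (λ k k≤n → p (suc k) (s≤s k≤n)) (λ k k≤n → q k (ℕ.m≤n⇒m≤1+n k≤n))) ⟩
  f′ 0 * g′ (suc n) + ((f′ ∘ suc) ⊛ g′) n    ≡⟨ ⊛-suc f′ g′ n ⟨
  (f′ ⊛ g′) (suc n)                          ∎
  where open ≡-Reasoning

⊛-distribʳ : ∀ h f g n → ((f ⊕ g) ⊛ h) n ≡ (f ⊛ h) n + (g ⊛ h) n
⊛-distribʳ h f g zero =
  solve 3 (λ x y z → (x :+ y) :* z :+ con 0ℚ := x :* z :+ con 0ℚ :+ (y :* z :+ con 0ℚ)) refl (f 0) (g 0) (h 0)
  where open +-*-Solver
⊛-distribʳ h f g (suc n) = begin
  ((f ⊕ g) ⊛ h) (suc n)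
    ≡⟨ ⊛-suc (f ⊕ g) h n ⟩
  (f 0 + g 0) * h (suc n) + (((f ∘ suc) ⊕ (g ∘ suc)) ⊛ h) n
    ≡⟨ cong (λ q → (f 0 + g 0) * h (suc n) + q) (⊛-distribʳ h (f ∘ suc) (g ∘ suc) n) ⟩
  (f 0 + g 0) * h (suc n) + (((f ∘ suc) ⊛ h) n + ((g ∘ suc) ⊛ h) n)
    ≡⟨ solve 5 (λ x y z u v → (x :+ y) :* z :+ (u :+ v) := x :* z :+ u :+ (y :* z :+ v)) refl
         (f 0) (g 0) (h (suc n)) (((f ∘ suc) ⊛ h) n) (((g ∘ suc) ⊛ h) n) ⟩
  f 0 * h (suc n) + ((f ∘ suc) ⊛ h) n + (g 0 * h (suc n) + ((g ∘ suc) ⊛ h) n)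
    ≡⟨ cong₂ _+_ (⊛-suc f h n) (⊛-suc g h n) ⟨
  (f ⊛ h) (suc n) + (g ⊛ h) (suc n) ∎
  where
  open ≡-Reasoning
  open +-*-Solver

⊛-scaleˡ : ∀ c f g n → ((λ k → c * f k) ⊛ g) n ≡ c * (f ⊛ g) n
⊛-scaleˡ c f g zero =
  solve 3 (λ x y z → x :* y :* z :+ con 0ℚ := x :* (y :* z :+ con 0ℚ)) refl c (f 0) (g 0)
  where open +-*-Solver
⊛-scaleˡ c f g (suc n) = begin
  ((λ k → c * f k) ⊛ g) (suc n)
    ≡⟨ ⊛-suc (λ k → c * f k) g n ⟩
  c * f 0 * g (suc n) + ((λ k → c * f (suc k)) ⊛ g) n
    ≡⟨ cong (λ q → c * f 0 * g (suc n) + q) (⊛-scaleˡ c (f ∘ suc) g n) ⟩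
  c * f 0 * g (suc n) + c * ((f ∘ suc) ⊛ g) n
    ≡⟨ solve 4 (λ x y z u → x :* y :* z :+ x :* u := x :* (y :* z :+ u)) refl
         c (f 0) (g (suc n)) (((f ∘ suc) ⊛ g) n) ⟩
  c * (f 0 * g (suc n) + ((f ∘ suc) ⊛ g) n)
    ≡⟨ cong (c *_) (⊛-suc f g n) ⟨
  c * (f ⊛ g) (suc n) ∎
  where
  open ≡-Reasoning
  open +-*-Solver

-- Splitting off the last summand mirrors `⊛-suc`; comparing the two gives commutativity.
⊛-sucʳ : ∀ f g n → (f ⊛ g) (suc n) ≡ f (suc n) * g 0 + (f ⊛ (g ∘ suc)) n
⊛-sucʳ f g zero = solve 4 (λ x y z u → x :* y :+ (z :* u :+ con 0ℚ) := z :* u :+ (x :* y :+ con 0ℚ)) refl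
    (f 0) (g 1) (f 1) (g 0)
  where open +-*-Solver
⊛-sucʳ f g (suc n) = begin
  (f ⊛ g) (2 ℕ.+ n)
    ≡⟨ ⊛-suc f g (suc n) ⟩
  f 0 * g (2 ℕ.+ n) + ((f ∘ suc) ⊛ g) (suc n)
    ≡⟨ cong (λ q → f 0 * g (2 ℕ.+ n) + q) (⊛-sucʳ (f ∘ suc) g n) ⟩
  f 0 * g (2 ℕ.+ n) + (f (2 ℕ.+ n) * g 0 + ((f ∘ suc) ⊛ (g ∘ suc)) n)
    ≡⟨ solve 3 (λ x y z → x :+ (y :+ z) := y :+ (x :+ z)) refl
         (f 0 * g (2 ℕ.+ n)) (f (2 ℕ.+ n) * g 0) (((f ∘ suc) ⊛ (g ∘ suc)) n) ⟩
  f (2 ℕ.+ n) * g 0 + (f 0 * g (2 ℕ.+ n) + ((f ∘ suc) ⊛ (g ∘ suc)) n)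
    ≡⟨ cong (λ q → f (2 ℕ.+ n) * g 0 + q) (⊛-suc f (g ∘ suc) n) ⟨
  f (2 ℕ.+ n) * g 0 + (f ⊛ (g ∘ suc)) (suc n) ∎
  where
  open ≡-Reasoning
  open +-*-Solver

⊛-comm : ∀ f g n → (f ⊛ g) n ≡ (g ⊛ f) n
⊛-comm f g zero = cong (_+ 0ℚ) (ℚ.*-comm (f 0) (g 0))
⊛-comm f g (suc n) = begin
  (f ⊛ g) (suc n)                      ≡⟨ ⊛-suc f g n ⟩
  f 0 * g (suc n) + ((f ∘ suc) ⊛ g) n  ≡⟨ cong₂ _+_ (ℚ.*-comm (f 0) (g (suc n))) (⊛-comm (f ∘ suc) g n) ⟩
  g (suc n) * f 0 + (g ⊛ (f ∘ suc)) n  ≡⟨ ⊛-sucʳ g f n ⟨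
  (g ⊛ f) (suc n)                      ∎
  where open ≡-Reasoning

⊛-assoc : ∀ f g h n → ((f ⊛ g) ⊛ h) n ≡ (f ⊛ (g ⊛ h)) n
⊛-assoc f g h zero =
  solve 3 (λ x y z → (x :* y :+ con 0ℚ) :* z :+ con 0ℚ := x :* (y :* z :+ con 0ℚ) :+ con 0ℚ) refl (f 0) (g 0) (h 0)
  where open +-*-Solver
⊛-assoc f g h (suc n) = begin
  ((f ⊛ g) ⊛ h) (suc n)
    ≡⟨ ⊛-suc (f ⊛ g) h n ⟩
  (f ⊛ g) 0 * h (suc n) + (((f ⊛ g) ∘ suc) ⊛ h) n
    ≡⟨ cong₂ _+_ (cong (_* h (suc n)) (⊛-zero f g))
         (⊛-local {g = h} n (λ k _ → ⊛-suc f g k) (λ _ _ → refl)) ⟩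
  f 0 * g 0 * h (suc n) + (((λ k → f 0 * g (suc k)) ⊕ ((f ∘ suc) ⊛ g)) ⊛ h) n
    ≡⟨ cong (λ q → f 0 * g 0 * h (suc n) + q) (⊛-distribʳ h (λ k → f 0 * g (suc k)) ((f ∘ suc) ⊛ g) n) ⟩
  f 0 * g 0 * h (suc n) + (((λ k → f 0 * g (suc k)) ⊛ h) n + (((f ∘ suc) ⊛ g) ⊛ h) n)
    ≡⟨ cong (λ q → f 0 * g 0 * h (suc n) + q)
         (cong₂ _+_ (⊛-scaleˡ (f 0) (g ∘ suc) h n) (⊛-assoc (f ∘ suc) g h n)) ⟩
  f 0 * g 0 * h (suc n) + (f 0 * ((g ∘ suc) ⊛ h) n + ((f ∘ suc) ⊛ (g ⊛ h)) n)
    ≡⟨ solve 5 (λ x y z u v → x :* y :* z :+ (x :* u :+ v) := x :* (y :* z :+ u) :+ v) refl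
         (f 0) (g 0) (h (suc n)) (((g ∘ suc) ⊛ h) n) (((f ∘ suc) ⊛ (g ⊛ h)) n) ⟩
  f 0 * (g 0 * h (suc n) + ((g ∘ suc) ⊛ h) n) + ((f ∘ suc) ⊛ (g ⊛ h)) n
    ≡⟨ cong (λ x → f 0 * x + ((f ∘ suc) ⊛ (g ⊛ h)) n) (⊛-suc g h n) ⟨
  f 0 * (g ⊛ h) (suc n) + ((f ∘ suc) ⊛ (g ⊛ h)) n
    ≡⟨ ⊛-suc f (g ⊛ h) n ⟨
  (f ⊛ (g ⊛ h)) (suc n) ∎
  where
  open ≡-Reasoning
  open +-*-Solver

⊛-zeroˡ : ∀ f n → (0ˢ ⊛ f) n ≡ 0ℚ
⊛-zeroˡ f zero    = trans (⊛-zero 0ˢ f) (ℚ.*-zeroˡ (f 0))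
⊛-zeroˡ f (suc n) = trans (⊛-suc 0ˢ f n)
  (trans (cong₂ _+_ (ℚ.*-zeroˡ (f (suc n))) (⊛-zeroˡ f n)) (ℚ.+-identityˡ 0ℚ))

const : ℚ → Series
const c zero    = c
const c (suc _) = 0ℚ

const-⊛ : ∀ c f n → (const c ⊛ f) n ≡ c * f n
const-⊛ c f zero    = ⊛-zero (const c) f
const-⊛ c f (suc n) = trans (⊛-suc (const c) f n)
  (trans (cong (λ q → c * f (suc n) + q) (⊛-zeroˡ f n)) (ℚ.+-identityʳ _))

const-const-⊛ : ∀ p q f n → (const p ⊛ const q ⊛ f) n ≡ p * q * f n
const-const-⊛ p q f n = trans (⊛-assoc (const p) (const q) f n) (trans (const-⊛ p (const q ⊛ f) n)
  (trans (cong (p *_) (const-⊛ q f n)) (sym (ℚ.*-assoc p q (f n)))))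

1ˢ≗const : ∀ n → 1ˢ n ≡ const 1ℚ n
1ˢ≗const zero    = refl
1ˢ≗const (suc _) = refl

⊛-identityˡ : ∀ f n → (1ˢ ⊛ f) n ≡ f n
⊛-identityˡ f n = trans (⊛-local {g = f} n (λ k _ → 1ˢ≗const k) (λ _ _ → refl))
  (trans (const-⊛ 1ℚ f n) (ℚ.*-identityˡ (f n)))

seriesRing : CommutativeRing 0ℓ 0ℓ
seriesRing = record
  { Carrier = Series
  ; _≈_ = _≈_
  ; _+_ = _⊕_
  ; _*_ = _⊛_
  ; -_ = ⊖_
  ; 0# = 0ˢ
  ; 1# = 1ˢ
  ; isCommutativeRing = record
    { isRing = record
      { +-isAbelianGroup = record
        { isGroup = record
          { isMonoid = record
            { isSemigroup = record
              { isMagma = record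
                { isEquivalence = record
                  { refl = pointwise λ _ → refl
                  ; sym = λ p → pointwise λ n → sym (at p n)
                  ; trans = λ p q → pointwise λ n → trans (at p n) (at q n)
                  }
                ; ∙-cong = λ p q → pointwise λ n → cong₂ _+_ (at p n) (at q n)
                }
              ; assoc = λ f g h → pointwise λ n → ℚ.+-assoc (f n) (g n) (h n)
              }
            ; identity = (λ f → pointwise λ n → ℚ.+-identityˡ (f n))
                       , (λ f → pointwise λ n → ℚ.+-identityʳ (f n))
            }
          ; inverse = (λ f → pointwise λ n → ℚ.+-inverseˡ (f n))
                    , (λ f → pointwise λ n → ℚ.+-inverseʳ (f n))
          ; ⁻¹-cong = λ p → pointwise λ n → cong -_ (at p n)
          }
        ; comm = λ f g → pointwise λ n → ℚ.+-comm (f n) (g n)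
        }
      ; *-cong = λ p q → pointwise λ n → ⊛-local n (λ k _ → at p k) (λ k _ → at q k)
      ; *-assoc = λ f g h → pointwise (⊛-assoc f g h)
      ; *-identity = (λ f → pointwise (⊛-identityˡ f))
                   , (λ f → pointwise λ n → trans (⊛-comm f 1ˢ n) (⊛-identityˡ f n))
      ; distrib = (λ h f g → pointwise λ n → trans (⊛-comm h (f ⊕ g) n)
                    (trans (⊛-distribʳ h f g n) (cong₂ _+_ (⊛-comm f h n) (⊛-comm g h n))))
                , (λ h f g → pointwise (⊛-distribʳ h f g))
      }
    ; *-comm = λ f g → pointwise (⊛-comm f g)
    }
  }

const-≟ : ∀ p q → Maybe (const p ≈ const q)
const-≟ p q with p ℚ.≟ q
... | yes refl = just (pointwise λ _ → refl)
... | no _     = nothing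

const-0 : const 0ℚ ≈ 0ˢ
const-0 = pointwise λ { zero → refl ; (suc _) → refl }

const-1 : const 1ℚ ≈ 1ˢ
const-1 = pointwise λ n → sym (1ˢ≗const n)

-- Equality of series is undecidable, so the solver takes its coefficients from ℚ. Since `con 1ℚ`
-- then denotes `const 1ℚ` and not `1ˢ`, later calls pass `1ˢ` as a variable `o` and remove it by
-- the unit law.
constant : CommutativeRing.rawRing ℚ.+-*-commutativeRing -Raw-AlmostCommutative⟶ fromCommutativeRing seriesRing
constant = record
  { ⟦_⟧ = const
  ; +-homo = λ p q → pointwise λ { zero → refl ; (suc _) → sym (ℚ.+-identityˡ 0ℚ) }
  ; *-homo = λ p q → pointwise λ { zero → sym (const-⊛ p (const q) 0)
                                 ; (suc n) → sym (trans (const-⊛ p (const q) (suc n)) (ℚ.*-zeroʳ p)) }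
  ; -‿homo = λ p → pointwise λ { zero → refl ; (suc _) → refl }
  ; 0-homo = const-0
  ; 1-homo = const-1
  }

module S where
  open CommutativeRing seriesRing public
  open Algebra.Properties.Semiring.Exp semiring public
  open Algebra.Properties.CommutativeMonoid.Sum *-commutativeMonoid public
    renaming (sum to prod; sum-cong-≋ to prod-cong; ∑-distrib-+ to prod-distrib-*; sum-replicate to prod-replicate)
    using ()

  module Solver = Algebra.Solver.Ring (CommutativeRing.rawRing ℚ.+-*-commutativeRing)
    (fromCommutativeRing seriesRing) constant const-≟

open S using (_^_)
module ≈-Reasoning = SetoidReasoning S.setoid

-- Reciprocals and exponentials

convFrom : Series → ∀ {m} → ℕ → Vec ℚ m → ℚ
convFrom f i []       = 0ℚ
convFrom f i (q ∷ qs) = f i * q + convFrom f (suc i) qs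

-- recipCoeffs uses a local function, which has no name outside Defs.  Here it is
-- found by unification: the `with` turns all of its arguments into variables.
mutual
  recipConv : (f : Series) → .{{NonZeroℚ (f 0)}} → ℕ → ∀ {m} → ℕ → Vec ℚ m → ℚ
  recipConv f n = _

  recip-suc-recipConv : ∀ f .{{_ : NonZeroℚ (f 0)}} n →
    recip f (suc n) ≡ - (1/ f 0) * recipConv f n 1 (recipCoeffs f n)
  recip-suc-recipConv f n with 1 | suc n | recipCoeffs f n
  ... | i | m | v = refl

recip-suc : ∀ f .{{_ : NonZeroℚ (f 0)}} n →
  recip f (suc n) ≡ - (1/ f 0) * convFrom f 1 (recipCoeffs f n)
recip-suc f n = trans (recip-suc-recipConv f n) (cong (- (1/ f 0) *_) (go 1 (recipCoeffs f n)))
  where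
  go : ∀ {m} i (v : Vec ℚ m) → recipConv f n i v ≡ convFrom f i v
  go i []      = refl
  go i (q ∷ v) = cong (λ x → f i * q + x) (go (suc i) v)

-- The vector lists the coefficients from n down to 0 while the index into `f` rises from `i`, which
-- is the pattern of a convolution with a shift of `f`. Naming that shift `g` lets the induction
-- raise `i`.
convFrom-recip : ∀ f .{{_ : NonZeroℚ (f 0)}} i g → (∀ k → g k ≡ f (i ℕ.+ k)) → ∀ n →
  convFrom f i (recipCoeffs f n) ≡ (g ⊛ recip f) n
convFrom-recip f i g g≗f zero =
  cong (λ x → x * recip f 0 + 0ℚ) (sym (trans (g≗f 0) (cong f (ℕ.+-identityʳ i))))
convFrom-recip f i g g≗f (suc n) = begin
  f i * recip f (suc n) + convFrom f (suc i) (recipCoeffs f n)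
    ≡⟨ cong₂ (λ x y → x * recip f (suc n) + y) (sym (trans (g≗f 0) (cong f (ℕ.+-identityʳ i))))
         (convFrom-recip f (suc i) (g ∘ suc) (λ k → trans (g≗f (suc k)) (cong f (ℕ.+-suc i k))) n) ⟩
  g 0 * recip f (suc n) + ((g ∘ suc) ⊛ recip f) n
    ≡⟨ ⊛-suc g (recip f) n ⟨
  (g ⊛ recip f) (suc n) ∎
  where open ≡-Reasoning

⊛-recip : ∀ f .{{_ : NonZeroℚ (f 0)}} → f ⊛ recip f ≈ 1ˢ
⊛-recip f = pointwise λ
  { zero    → trans (⊛-zero f (recip f)) (ℚ.*-inverseʳ (f 0))
  ; (suc n) → begin
      (f ⊛ recip f) (suc n)
        ≡⟨ ⊛-suc f (recip f) n ⟩
      f 0 * recip f (suc n) + ((f ∘ suc) ⊛ recip f) n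
        ≡⟨ cong₂ (λ x y → f 0 * x + y) (recip-suc f n) (sym (convFrom-recip f 1 (f ∘ suc) (λ _ → refl) n)) ⟩
      f 0 * (- (1/ f 0) * conv n) + conv n
        ≡⟨ solve 3 (λ x y z → x :* (:- y :* z) :+ z := (con 1ℚ :- x :* y) :* z) refl (f 0) (1/ f 0) (conv n) ⟩
      (1ℚ - f 0 * 1/ f 0) * conv n
        ≡⟨ cong (λ x → (1ℚ - x) * conv n) (ℚ.*-inverseʳ (f 0)) ⟩
      0ℚ * conv n
        ≡⟨ ℚ.*-zeroˡ (conv n) ⟩
      0ℚ ∎ }
  where
  open ≡-Reasoning
  open +-*-Solver
  conv : ℕ → ℚ
  conv n = convFrom f 1 (recipCoeffs f n)

-- The operator t d/dt, logarithmic derivatives and the exponential series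

X : Series
X zero    = 0ℚ
X (suc n) = 1ˢ n

X-⊛-zero : ∀ f → (X ⊛ f) 0 ≡ 0ℚ
X-⊛-zero f = trans (⊛-zero X f) (ℚ.*-zeroˡ (f 0))

X-⊛-suc : ∀ f n → (X ⊛ f) (suc n) ≡ f n
X-⊛-suc f n = trans (⊛-suc X f n)
  (trans (cong₂ _+_ (ℚ.*-zeroˡ (f (suc n))) (⊛-identityˡ f n)) (ℚ.+-identityˡ (f n)))

X-cancelˡ : ∀ {f g} → X ⊛ f ≈ X ⊛ g → f ≈ g
X-cancelˡ {f} {g} p = pointwise λ n → trans (sym (X-⊛-suc f n)) (trans (at p (suc n)) (X-⊛-suc g n))

-- t d/dt
θ : Series → Series
θ f n = fromℕ n * f n

θ-cong : ∀ {f g} → f ≈ g → θ f ≈ θ g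
θ-cong p = pointwise λ n → cong (fromℕ n *_) (at p n)

θ-⊛ : ∀ f g → θ (f ⊛ g) ≈ θ f ⊛ g ⊕ f ⊛ θ g
θ-⊛ f g = pointwise (go f g)
  where
  open ≡-Reasoning
  open +-*-Solver
  go : ∀ f g n → θ (f ⊛ g) n ≡ (θ f ⊛ g ⊕ f ⊛ θ g) n
  go f g zero = solve 2 (λ x y → con 0ℚ :* (x :* y :+ con 0ℚ)
      := con 0ℚ :* x :* y :+ con 0ℚ :+ (x :* (con 0ℚ :* y) :+ con 0ℚ)) refl (f 0) (g 0)
  go f g (suc n) = begin
    N * (f ⊛ g) (suc n)
      ≡⟨ cong (N *_) (⊛-suc f g n) ⟩
    N * (f 0 * g (suc n) + fg)
      ≡⟨ solve 4 (λ N x y z → N :* (x :* y :+ z) := x :* (N :* y) :+ N :* z) refl N (f 0) (g (suc n)) fg ⟩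
    f 0 * (N * g (suc n)) + N * fg
      ≡⟨ cong (λ m → f 0 * (N * g (suc n)) + m * fg) (fromℕ-homo-+ 1 n) ⟩
    f 0 * (N * g (suc n)) + (1ℚ + fromℕ n) * fg
      ≡⟨ solve 3 (λ x n z → x :+ (con 1ℚ :+ n) :* z := x :+ (z :+ n :* z)) refl (f 0 * (N * g (suc n))) (fromℕ n) fg ⟩
    f 0 * (N * g (suc n)) + (fg + θ ((f ∘ suc) ⊛ g) n)
      ≡⟨ cong (λ x → f 0 * (N * g (suc n)) + (fg + x)) (go (f ∘ suc) g n) ⟩
    f 0 * (N * g (suc n)) + (fg + ((θ (f ∘ suc) ⊛ g) n + ((f ∘ suc) ⊛ θ g) n))
      ≡⟨ solve 6 (λ x y z u v w → x :+ (z :+ (u :+ v)) := con 0ℚ :* y :* w :+ (z :+ u) :+ (x :+ v)) refl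
           (f 0 * (N * g (suc n))) (f 0) fg ((θ (f ∘ suc) ⊛ g) n) (((f ∘ suc) ⊛ θ g) n) (g (suc n)) ⟩
    0ℚ * f 0 * g (suc n) + (fg + (θ (f ∘ suc) ⊛ g) n) + (f 0 * (N * g (suc n)) + ((f ∘ suc) ⊛ θ g) n)
      ≡⟨ cong (λ x → 0ℚ * f 0 * g (suc n) + x + (f 0 * (N * g (suc n)) + ((f ∘ suc) ⊛ θ g) n))
           (trans (sym (⊛-distribʳ g (f ∘ suc) (θ (f ∘ suc)) n))
             (⊛-local {g = g} n (λ k _ → θ-suc k) (λ _ _ → refl))) ⟩
    0ℚ * f 0 * g (suc n) + ((θ f ∘ suc) ⊛ g) n + (f 0 * (N * g (suc n)) + ((f ∘ suc) ⊛ θ g) n)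
      ≡⟨ cong₂ _+_ (⊛-suc (θ f) g n) (⊛-suc f (θ g) n) ⟨
    (θ f ⊛ g) (suc n) + (f ⊛ θ g) (suc n) ∎
    where
    N = fromℕ (suc n)
    fg = ((f ∘ suc) ⊛ g) n
    θ-suc : ∀ k → f (suc k) + fromℕ k * f (suc k) ≡ fromℕ (suc k) * f (suc k)
    θ-suc k = trans (solve 2 (λ x y → y :+ x :* y := (con 1ℚ :+ x) :* y) refl (fromℕ k) (f (suc k)))
      (cong (_* f (suc k)) (sym (fromℕ-homo-+ 1 k)))

θ-⊕ : ∀ f g → θ (f ⊕ g) ≈ θ f ⊕ θ g
θ-⊕ f g = pointwise λ n → ℚ.*-distribˡ-+ (fromℕ n) (f n) (g n)

θ-1 : θ 1ˢ ≈ 0ˢ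
θ-1 = pointwise λ { zero → refl ; (suc n) → ℚ.*-zeroʳ (fromℕ (suc n)) }

θ-X : θ X ≈ X
θ-X = pointwise λ { zero → refl ; 1 → refl ; (suc (suc n)) → ℚ.*-zeroʳ (fromℕ (suc (suc n))) }

-- Here `q` is the logarithmic derivative of `f`, and logarithmic derivatives add under products.
-- The multiplicative form makes sense even when `f` has no reciprocal, as for `X`.
θ-^ : ∀ {f q} → θ f ≈ f ⊛ q → ∀ k → θ (f ^ k) ≈ f ^ k ⊛ (const (fromℕ k) ⊛ q)
θ-^ {f} {q} p zero = S.trans θ-1 (S.sym (S.trans (S.*-identityˡ (const 0ℚ ⊛ q)) (S.trans (S.*-congʳ {q} const-0) (S.zeroˡ q))))
θ-^ {f} {q} p (suc k) = begin
  θ (f ⊛ f ^ k)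
    ≈⟨ θ-⊛ f (f ^ k) ⟩
  θ f ⊛ f ^ k ⊕ f ⊛ θ (f ^ k)
    ≈⟨ S.+-cong (S.*-congʳ {f ^ k} p) (S.*-congˡ {f} (θ-^ p k)) ⟩
  f ⊛ q ⊛ f ^ k ⊕ f ⊛ (f ^ k ⊛ (const (fromℕ k) ⊛ q))
    ≈⟨ solve 4 (λ f q g c → f :* q :* g :+ f :* (g :* (c :* q)) := f :* g :* ((con 1ℚ :+ c) :* q)) S.refl
         f q (f ^ k) (const (fromℕ k)) ⟩
  f ⊛ f ^ k ⊛ ((const 1ℚ ⊕ const (fromℕ k)) ⊛ q)
    ≈⟨ S.*-congˡ {f ⊛ f ^ k} (S.*-congʳ {q} (1+const k)) ⟩
  f ⊛ f ^ k ⊛ (const (fromℕ (suc k)) ⊛ q) ∎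
  where
  open ≈-Reasoning
  open S.Solver
  1+const : ∀ k → const 1ℚ ⊕ const (fromℕ k) ≈ const (fromℕ (suc k))
  1+const k = pointwise λ { zero → sym (fromℕ-homo-+ 1 k) ; (suc _) → refl }

θ-⊛-^ : ∀ {e f u q} → θ e ≈ e ⊛ u → θ f ≈ f ⊛ q → ∀ k →
  θ (e ⊛ f ^ k) ≈ e ⊛ f ^ k ⊛ (u ⊕ const (fromℕ k) ⊛ q)
θ-⊛-^ {e} {f} {u} {q} θe θf k = begin
  θ (e ⊛ f ^ k)
    ≈⟨ θ-⊛ e (f ^ k) ⟩
  θ e ⊛ f ^ k ⊕ e ⊛ θ (f ^ k)
    ≈⟨ S.+-cong (S.*-congʳ {f ^ k} θe) (S.*-congˡ {e} (θ-^ θf k)) ⟩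
  e ⊛ u ⊛ f ^ k ⊕ e ⊛ (f ^ k ⊛ (const (fromℕ k) ⊛ q))
    ≈⟨ solve 5 (λ e u g c q → e :* u :* g :+ e :* (g :* (c :* q)) := e :* g :* (u :+ c :* q)) S.refl
         e u (f ^ k) (const (fromℕ k)) q ⟩
  e ⊛ f ^ k ⊛ (u ⊕ const (fromℕ k) ⊛ q) ∎
  where
  open ≈-Reasoning
  open S.Solver

-- Differentiating v w = 1 gives θ w = - w² θ v; one `w` is kept in front to match the hypothesis of
-- `θ-^`.
θ-inverse : ∀ {v w} → v ⊛ w ≈ 1ˢ → θ w ≈ w ⊛ (⊖ (w ⊛ θ v))
θ-inverse {v} {w} vw≈1 = begin
  θ w
    ≈⟨ S.*-identityˡ (θ w) ⟨
  1ˢ ⊛ θ w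
    ≈⟨ S.*-congʳ {θ w} vw≈1 ⟨
  v ⊛ w ⊛ θ w
    -- The term w (w θ v) is added and subtracted so that the derivative of v w appears, which is 0.
    ≈⟨ solve 4 (λ v w x y → v :* w :* x := w :* (y :* w :+ v :* x) :- w :* (w :* y)) S.refl v w (θ w) (θ v) ⟩
  w ⊛ (θ v ⊛ w ⊕ v ⊛ θ w) ⊕ ⊖ (w ⊛ (w ⊛ θ v))
    ≈⟨ S.+-congʳ {⊖ (w ⊛ (w ⊛ θ v))} (S.*-congˡ {w} (S.trans (S.sym (θ-⊛ v w)) (S.trans (θ-cong vw≈1) θ-1))) ⟩
  w ⊛ 0ˢ ⊕ ⊖ (w ⊛ (w ⊛ θ v))
    ≈⟨ S.+-congʳ {⊖ (w ⊛ (w ⊛ θ v))} (S.zeroʳ w) ⟩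
  0ˢ ⊕ ⊖ (w ⊛ (w ⊛ θ v))
    ≈⟨ S.+-identityˡ (⊖ (w ⊛ (w ⊛ θ v))) ⟩
  ⊖ (w ⊛ (w ⊛ θ v))
    ≈⟨ solve 2 (λ w y → :- (w :* (w :* y)) := w :* :- (w :* y)) S.refl w (θ v) ⟩
  w ⊛ (⊖ (w ⊛ θ v)) ∎
  where
  open ≈-Reasoning
  open S.Solver

1÷!-suc : ∀ k → fromℕ (suc k) * (+ 1 / suc k !) {{suc k !≢0}} ≡ (+ 1 / k !) {{k !≢0}}
1÷!-suc k = fromℕ-cancelˡ (k !) {{k !≢0}} (begin
  fromℕ (k !) * (fromℕ (suc k) * u)
    ≡⟨ solve 3 (λ x y z → x :* (y :* z) := z :* (y :* x)) refl (fromℕ (k !)) (fromℕ (suc k)) u ⟩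
  u * (fromℕ (suc k) * fromℕ (k !))
    ≡⟨ cong (u *_) (fromℕ-homo-* (suc k) (k !)) ⟨
  u * fromℕ (suc k !)
    ≡⟨ 1÷-inverseˡ (suc k !) {{suc k !≢0}} ⟩
  1ℚ
    ≡⟨ 1÷-inverseˡ (k !) {{k !≢0}} ⟨
  v * fromℕ (k !)
    ≡⟨ ℚ.*-comm v (fromℕ (k !)) ⟩
  fromℕ (k !) * v ∎)
  where
  open ≡-Reasoning
  open +-*-Solver
  u = (+ 1 / suc k !) {{suc k !≢0}}
  v = (+ 1 / k !) {{k !≢0}}

exp-suc : ∀ c k → fromℕ (suc k) * exp c (suc k) ≡ c * exp c k
exp-suc c k = trans
  (solve 4 (λ n c x u → n :* (c :* x :* u) := c :* (x :* (n :* u))) refl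
    (fromℕ (suc k)) c (c Defs.^ k) ((+ 1 / suc k !) {{suc k !≢0}}))
  (cong (λ u → c * (c Defs.^ k * u)) (1÷!-suc k))
  where open +-*-Solver

⊛-const-X-zero : ∀ f c → (f ⊛ (const c ⊛ X)) 0 ≡ 0ℚ
⊛-const-X-zero f c = solve 2 (λ x y → x :* (y :* con 0ℚ :+ con 0ℚ) :+ con 0ℚ := con 0ℚ) refl (f 0) c
  where open +-*-Solver

⊛-const-X-suc : ∀ f c n → (f ⊛ (const c ⊛ X)) (suc n) ≡ c * f n
⊛-const-X-suc f c n = begin
  (f ⊛ (const c ⊛ X)) (suc n) ≡⟨ at (solve 3 (λ f c x → f :* (c :* x) := x :* (c :* f)) S.refl f (const c) X) (suc n) ⟩
  (X ⊛ (const c ⊛ f)) (suc n) ≡⟨ X-⊛-suc (const c ⊛ f) n ⟩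
  (const c ⊛ f) n             ≡⟨ const-⊛ c f n ⟩
  c * f n                     ∎
  where
  open ≡-Reasoning
  open S.Solver

θ-exp : ∀ c → θ (exp c) ≈ exp c ⊛ (const c ⊛ X)
θ-exp c = pointwise λ
  { zero    → trans (ℚ.*-zeroˡ (exp c 0)) (sym (⊛-const-X-zero (exp c) c))
  ; (suc n) → trans (exp-suc c n) (sym (⊛-const-X-suc (exp c) c n)) }

-- In degree n + 1 the differential equation reads (n + 1) fₙ₊₁ = c fₙ, so it determines every
-- coefficient from the constant one. The functional equations of `exp` follow by checking that both
-- sides are solutions.
exp-unique : ∀ c {f g} → f 0 ≡ g 0 → θ f ≈ f ⊛ (const c ⊛ X) → θ g ≈ g ⊛ (const c ⊛ X) → f ≈ g
exp-unique c {f} {g} f₀≡g₀ θf θg = pointwise go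
  where
  go : ∀ n → f n ≡ g n
  go zero    = f₀≡g₀
  go (suc n) = fromℕ-cancelˡ (suc n)
    (trans (at θf (suc n)) (trans (⊛-const-X-suc f c n) (trans (cong (c *_) (go n))
      (sym (trans (at θg (suc n)) (⊛-const-X-suc g c n))))))

exp-homo-+ : ∀ c d → exp (c + d) ≈ exp c ⊛ exp d
exp-homo-+ c d = exp-unique (c + d) refl (θ-exp (c + d)) (begin
  θ (exp c ⊛ exp d)
    ≈⟨ θ-⊛ (exp c) (exp d) ⟩
  θ (exp c) ⊛ exp d ⊕ exp c ⊛ θ (exp d)
    ≈⟨ S.+-cong (S.*-congʳ {exp d} (θ-exp c)) (S.*-congˡ {exp c} (θ-exp d)) ⟩
  exp c ⊛ (const c ⊛ X) ⊛ exp d ⊕ exp c ⊛ (exp d ⊛ (const d ⊛ X))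
    ≈⟨ solve 5 (λ x y c d t → x :* (c :* t) :* y :+ x :* (y :* (d :* t)) := x :* y :* ((c :+ d) :* t)) S.refl
         (exp c) (exp d) (const c) (const d) X ⟩
  exp c ⊛ exp d ⊛ ((const c ⊕ const d) ⊛ X)
    ≈⟨ S.*-congˡ {exp c ⊛ exp d} (S.*-congʳ {X} const-+) ⟩
  exp c ⊛ exp d ⊛ (const (c + d) ⊛ X) ∎)
  where
  open ≈-Reasoning
  open S.Solver
  const-+ : const c ⊕ const d ≈ const (c + d)
  const-+ = pointwise λ { zero → refl ; (suc _) → refl }

exp-0 : exp 0ℚ ≈ 1ˢ
exp-0 = exp-unique 0ℚ refl (θ-exp 0ℚ)
  (S.trans θ-1 (S.sym (S.trans (S.*-identityˡ (const 0ℚ ⊛ X)) (S.trans (S.*-congʳ {X} const-0) (S.zeroˡ X)))))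

-- Solving the first-order recursion by a product

∏-∷ʳ : ∀ {A : Set} (xs : List A) x f → ∏ (xs ∷ʳ x) f ≡ ∏ xs f * f x
∏-∷ʳ []       x f = ℚ.*-comm (f x) 1ℚ
∏-∷ʳ (y ∷ xs) x f = trans (cong (f y *_) (∏-∷ʳ xs x f)) (sym (ℚ.*-assoc (f y) (∏ xs f) (f x)))

-- Divided by (k + 1) D, the recursion contributes the factor y / D + (k + 1) to the product and 1 /
-- (k + 1) to the factorial. The initial value `h 1` is left open because it differs between the two
-- applications.
rising-product : ∀ (h : ℕ → ℚ) y D .{{_ : NonZero D}} →
  (∀ k → fromℕ (suc k) * fromℕ D * h (suc (suc k)) ≡ (y + fromℕ (suc k) * fromℕ D) * h (suc k)) →
  ∀ k → h (suc k) ≡ (1ℚ ÷ℕ k !) {{k !≢0}} * (∏[ ℓ ← applyUpTo suc k ] (y ÷ℕ D + fromℕ ℓ)) * h 1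
rising-product h y D step zero    = sym (trans (ℚ.*-assoc 1ℚ 1ℚ (h 1)) (trans (ℚ.*-identityˡ _) (ℚ.*-identityˡ _)))
rising-product h y D step (suc k) = fromℕ-cancelˡ (suc k) (fromℕ-cancelˡ D (begin
  d * (s * h (2 ℕ.+ k))
    ≡⟨ solve 3 (λ d s x → d :* (s :* x) := s :* d :* x) refl d s (h (2 ℕ.+ k)) ⟩
  s * d * h (2 ℕ.+ k)
    ≡⟨ step k ⟩
  (y + s * d) * h (suc k)
    ≡⟨ cong ((y + s * d) *_) (rising-product h y D step k) ⟩
  (y + s * d) * (1ℚ * v * Π * h 1)
    ≡⟨ solve 6 (λ y s d v p h → (y :+ s :* d) :* (con 1ℚ :* v :* p :* h) := (y :* con 1ℚ :+ s :* d) :* (v :* p :* h)) refl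
         y s d v Π (h 1) ⟩
  (y * 1ℚ + s * d) * (v * Π * h 1)
    ≡⟨ cong₂ (λ x z → (y * x + s * d) * (z * Π * h 1)) (sym (1÷-inverseˡ D)) (sym (1÷!-suc k)) ⟩
  (y * (i * d) + s * d) * (s * u * Π * h 1)
    ≡⟨ solve 7 (λ y i d s u p h → (y :* (i :* d) :+ s :* d) :* (s :* u :* p :* h)
         := d :* (s :* (con 1ℚ :* u :* (p :* (y :* i :+ s)) :* h))) refl y i d s u Π (h 1) ⟩
  d * (s * (1ℚ * u * (Π * (y * i + s)) * h 1))
    ≡⟨ cong (λ p → d * (s * (1ℚ * u * p * h 1)))
         (trans (sym (∏-∷ʳ (applyUpTo suc k) (suc k) F)) (cong (λ xs → ∏ xs F) (applyUpTo-∷ʳ suc k))) ⟩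
  d * (s * (1ℚ * u * ∏ (applyUpTo suc (suc k)) F * h 1)) ∎))
  where
  open ≡-Reasoning
  open +-*-Solver
  F : ℕ → ℚ
  F ℓ = y ÷ℕ D + fromℕ ℓ
  s = fromℕ (suc k)
  d = fromℕ D
  i = + 1 / D
  u = (+ 1 / suc k !) {{suc k !≢0}}
  v = (+ 1 / k !) {{k !≢0}}
  Π = ∏ (applyUpTo suc k) F

-- Sums over boxes and geometric sums

private variable
  I J : Set

∑-cong-∈ : ∀ (xs : List I) {f g : I → ℚ} → (∀ {x} → x ∈ xs → f x ≡ g x) → ∑ xs f ≡ ∑ xs g
∑-cong-∈ []       p = refl
∑-cong-∈ (x ∷ xs) p = cong₂ _+_ (p (here refl)) (∑-cong-∈ xs (p ∘ there))

∑-cong : ∀ (xs : List I) {f g : I → ℚ} → (∀ x → f x ≡ g x) → ∑ xs f ≡ ∑ xs g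
∑-cong xs p = ∑-cong-∈ xs (λ {x} _ → p x)

∑-0 : ∀ (xs : List I) → (∑[ _ ← xs ] 0ℚ) ≡ 0ℚ
∑-0 []       = refl
∑-0 (_ ∷ xs) = trans (ℚ.+-identityˡ (∑[ _ ← xs ] 0ℚ)) (∑-0 xs)

∑-distribˡ : ∀ c (xs : List I) (f : I → ℚ) → c * ∑ xs f ≡ ∑[ x ← xs ] (c * f x)
∑-distribˡ c []       f = ℚ.*-zeroʳ c
∑-distribˡ c (x ∷ xs) f = trans (ℚ.*-distribˡ-+ c (f x) (∑ xs f)) (cong (λ y → c * f x + y) (∑-distribˡ c xs f))

∑-map : ∀ (g : I → J) xs (f : J → ℚ) → ∑ (map g xs) f ≡ ∑ xs (f ∘ g)
∑-map g []       f = refl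
∑-map g (x ∷ xs) f = cong (λ z → f (g x) + z) (∑-map g xs f)

∑-++ : ∀ (xs ys : List I) f → ∑ (xs ++ ys) f ≡ ∑ xs f + ∑ ys f
∑-++ []       ys f = sym (ℚ.+-identityˡ (∑ ys f))
∑-++ (x ∷ xs) ys f = trans (cong (λ z → f x + z) (∑-++ xs ys f)) (sym (ℚ.+-assoc (f x) (∑ xs f) (∑ ys f)))

∑-cartesianProductWith : ∀ {K : Set} (g : I → J → K) xs ys (f : K → ℚ) →
  ∑ (cartesianProductWith g xs ys) f ≡ (∑[ x ← xs ] ∑[ y ← ys ] f (g x y))
∑-cartesianProductWith g []       ys f = refl
∑-cartesianProductWith g (x ∷ xs) ys f =
  trans (∑-++ (map (g x) ys) (cartesianProductWith g xs ys) f)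
    (cong₂ _+_ (∑-map (g x) ys f) (∑-cartesianProductWith g xs ys f))

∑-upTo-suc : ∀ n (f : ℕ → ℚ) → ∑ (upTo (suc n)) f ≡ f 0 + ∑ (upTo n) (f ∘ suc)
∑-upTo-suc n f = cong (λ xs → f 0 + foldr _+_ 0ℚ xs)
  (trans (map-applyUpTo suc f n) (sym (map-applyUpTo id (f ∘ suc) n)))

∑-upTo-+ : ∀ m n (f : ℕ → ℚ) → ∑ (upTo (m ℕ.+ n)) f ≡ ∑ (upTo m) f + (∑[ k ← upTo n ] f (m ℕ.+ k))
∑-upTo-+ zero    n f = sym (ℚ.+-identityˡ (∑ (upTo n) f))
∑-upTo-+ (suc m) n f = begin
  ∑ (upTo (suc m ℕ.+ n)) f                                                 ≡⟨ ∑-upTo-suc (m ℕ.+ n) f ⟩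
  f 0 + ∑ (upTo (m ℕ.+ n)) (f ∘ suc)                                       ≡⟨ cong (λ z → f 0 + z) (∑-upTo-+ m n (f ∘ suc)) ⟩
  f 0 + (∑ (upTo m) (f ∘ suc) + (∑[ k ← upTo n ] f (suc m ℕ.+ k)))         ≡⟨ ℚ.+-assoc (f 0) (∑ (upTo m) (f ∘ suc)) (∑[ k ← upTo n ] f (suc m ℕ.+ k)) ⟨
  f 0 + ∑ (upTo m) (f ∘ suc) + (∑[ k ← upTo n ] f (suc m ℕ.+ k))           ≡⟨ cong (_+ (∑[ k ← upTo n ] f (suc m ℕ.+ k))) (∑-upTo-suc m f) ⟨
  ∑ (upTo (suc m)) f + (∑[ k ← upTo n ] f (suc m ℕ.+ k))                   ∎
  where open ≡-Reasoning

-- The Iverson bracket. It turns filtered lists into weighted sums over a whole box, where factors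
-- can be separated.
⟪_⟫ : ∀ {P : Set} → Dec P → ℚ
⟪ P? ⟫ = if does P? then 1ℚ else 0ℚ

∑-filter : ∀ {P : I → Set} (P? : Decidable P) xs f → ∑ (filter P? xs) f ≡ (∑[ x ← xs ] (⟪ P? x ⟫ * f x))
∑-filter P? []       f = refl
∑-filter P? (x ∷ xs) f with P? x
... | yes _ = cong₂ _+_ (sym (ℚ.*-identityˡ (f x))) (∑-filter P? xs f)
... | no _  = trans (∑-filter P? xs f)
  (trans (sym (ℚ.+-identityˡ _)) (cong (_+ (∑[ x ← xs ] (⟪ P? x ⟫ * f x))) (sym (ℚ.*-zeroˡ (f x)))))

fromℕ-length : ∀ (xs : List I) → fromℕ (List.length xs) ≡ (∑[ _ ← xs ] 1ℚ)
fromℕ-length []       = refl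
fromℕ-length (x ∷ xs) = trans (fromℕ-homo-+ 1 (List.length xs)) (cong (λ z → 1ℚ + z) (fromℕ-length xs))

∑ˢ : List I → (I → Series) → Series
∑ˢ xs f n = ∑[ x ← xs ] f x n

∑ˢ-cong : ∀ (xs : List I) {f g : I → Series} → (∀ x → f x ≈ g x) → ∑ˢ xs f ≈ ∑ˢ xs g
∑ˢ-cong xs p = pointwise λ n → ∑-cong xs (λ x → at (p x) n)

∑ˢ-⊛ʳ : ∀ (xs : List I) (f : I → Series) g → ∑ˢ xs f ⊛ g ≈ ∑ˢ xs (λ x → f x ⊛ g)
∑ˢ-⊛ʳ []       f g = S.zeroˡ g
∑ˢ-⊛ʳ (x ∷ xs) f g = S.trans (S.distribʳ g (f x) (∑ˢ xs f))
  (S.+-congˡ {f x ⊛ g} (∑ˢ-⊛ʳ xs f g))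

∑ˢ-⊛ˡ : ∀ (xs : List I) g (f : I → Series) → g ⊛ ∑ˢ xs f ≈ ∑ˢ xs (λ x → g ⊛ f x)
∑ˢ-⊛ˡ xs g f = S.trans (S.*-comm g (∑ˢ xs f))
  (S.trans (∑ˢ-⊛ʳ xs f g) (∑ˢ-cong xs (λ x → S.*-comm (f x) g)))

-- The distributive law for a product of sums. It serves for the choices of ε, for those of j, and
-- for the candidate solutions x.
∑ˢ-box : ∀ {r} (b : Vec ℕ r) (F : Fin r → ℕ → Series) →
  ∑ˢ (box b) (λ x → S.prod (λ i → F i (lookup x i))) ≈ S.prod (λ i → ∑ˢ (upTo (lookup b i)) (F i))
∑ˢ-box []       F = S.+-identityʳ 1ˢ
∑ˢ-box (b ∷ bs) F = begin
  ∑ˢ (box (b ∷ bs)) (λ x → S.prod (λ i → F i (lookup x i)))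
    ≈⟨ pointwise (λ n → ∑-cartesianProductWith _∷_ (upTo b) (box bs) (λ x → S.prod (λ i → F i (lookup x i)) n)) ⟩
  ∑ˢ (upTo b) (λ y → ∑ˢ (box bs) (λ x → F zero y ⊛ tail x))
    ≈⟨ ∑ˢ-cong (upTo b) (λ y → ∑ˢ-⊛ˡ (box bs) (F zero y) tail) ⟨
  ∑ˢ (upTo b) (λ y → F zero y ⊛ ∑ˢ (box bs) tail)
    ≈⟨ ∑ˢ-⊛ʳ (upTo b) (F zero) (∑ˢ (box bs) tail) ⟨
  ∑ˢ (upTo b) (F zero) ⊛ ∑ˢ (box bs) tail
    ≈⟨ S.*-congˡ {∑ˢ (upTo b) (F zero)} (∑ˢ-box bs (F ∘ suc)) ⟩
  ∑ˢ (upTo b) (F zero) ⊛ S.prod (λ i → ∑ˢ (upTo (lookup bs i)) (F (suc i))) ∎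
  where
  open ≈-Reasoning
  tail : Vec ℕ _ → Series
  tail x = S.prod (λ i → F (suc i) (lookup x i))

-- `φ m` plays the role of q^m, so that the expansion over ε and j is carried out once for both
-- values of q.
record IsExponential (φ : ℕ → Series) : Set where
  field
    homo-0 : φ 0 ≈ 1ˢ
    homo-+ : ∀ m n → φ (m ℕ.+ n) ≈ φ m ⊛ φ n

X^-isExponential : IsExponential (X ^_)
X^-isExponential = record { homo-0 = S.refl ; homo-+ = S.^-homo-* X }

exp-isExponential : IsExponential (λ m → exp (- fromℕ m))
exp-isExponential = record
  { homo-0 = exp-0
  ; homo-+ = λ m n → S.trans
      (S.reflexive (cong exp (trans (cong -_ (fromℕ-homo-+ m n)) (ℚ.neg-distrib-+ (fromℕ m) (fromℕ n)))))
      (exp-homo-+ (- fromℕ m) (- fromℕ n))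
  }

module _ {φ : ℕ → Series} (isExponential : IsExponential φ) where
  open IsExponential isExponential

  φ-∙ : ∀ {r} (a x : Vec ℕ r) → φ (a ∙ x) ≈ S.prod (λ i → φ (lookup a i ℕ.* lookup x i))
  φ-∙ []      []      = homo-0
  φ-∙ (a ∷ as) (x ∷ xs) = S.trans (homo-+ (a ℕ.* x) (as ∙ xs)) (S.*-congˡ {φ (a ℕ.* x)} (φ-∙ as xs))

  -- Stated without a quotient, because for the exponentials 1 - φ c has constant term 0 and so no
  -- reciprocal series.
  geometric-sum : ∀ c N → (1ˢ ⊕ ⊖ φ c) ⊛ ∑ˢ (upTo N) (λ j → φ (c ℕ.* j)) ≈ 1ˢ ⊕ ⊖ φ (c ℕ.* N)
  geometric-sum c zero    = begin
    (1ˢ ⊕ ⊖ φ c) ⊛ 0ˢ    ≈⟨ S.zeroʳ (1ˢ ⊕ ⊖ φ c) ⟩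
    0ˢ                    ≈⟨ S.-‿inverseʳ 1ˢ ⟨
    1ˢ ⊕ ⊖ 1ˢ             ≈⟨ S.+-congˡ {1ˢ} (S.-‿cong (S.trans (S.reflexive (cong φ (ℕ.*-zeroʳ c))) homo-0)) ⟨
    1ˢ ⊕ ⊖ φ (c ℕ.* 0)    ∎
    where open ≈-Reasoning
  geometric-sum c (suc N) = begin
    (1ˢ ⊕ ⊖ φ c) ⊛ ∑ˢ (upTo (suc N)) (λ j → φ (c ℕ.* j))
      ≈⟨ S.*-congˡ {1ˢ ⊕ ⊖ φ c} (pointwise λ n → ∑-upTo-suc N (λ j → φ (c ℕ.* j) n)) ⟩
    (1ˢ ⊕ ⊖ φ c) ⊛ (φ (c ℕ.* 0) ⊕ ∑ˢ (upTo N) (λ j → φ (c ℕ.* suc j)))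
      ≈⟨ S.*-congˡ {1ˢ ⊕ ⊖ φ c} (S.+-cong (S.trans (S.reflexive (cong φ (ℕ.*-zeroʳ c))) homo-0)
           (S.trans (∑ˢ-cong (upTo N) φ-suc) (S.sym (∑ˢ-⊛ˡ (upTo N) (φ c) (λ j → φ (c ℕ.* j)))))) ⟩
    (1ˢ ⊕ ⊖ φ c) ⊛ (1ˢ ⊕ φ c ⊛ G)
      ≈⟨ solve 3 (λ o x g → (o :- x) :* (o :+ x :* g) := (o :- x) :* o :+ x :* ((o :- x) :* g)) S.refl 1ˢ (φ c) G ⟩
    (1ˢ ⊕ ⊖ φ c) ⊛ 1ˢ ⊕ φ c ⊛ ((1ˢ ⊕ ⊖ φ c) ⊛ G)
      ≈⟨ S.+-cong (S.*-identityʳ (1ˢ ⊕ ⊖ φ c)) (S.*-congˡ {φ c} (geometric-sum c N)) ⟩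
    (1ˢ ⊕ ⊖ φ c) ⊕ φ c ⊛ (1ˢ ⊕ ⊖ φ (c ℕ.* N))
      ≈⟨ S.+-congˡ {1ˢ ⊕ ⊖ φ c} (S.trans (S.distribˡ (φ c) 1ˢ (⊖ φ (c ℕ.* N))) (S.+-congʳ {φ c ⊛ (⊖ φ (c ℕ.* N))} (S.*-identityʳ (φ c)))) ⟩
    (1ˢ ⊕ ⊖ φ c) ⊕ (φ c ⊕ φ c ⊛ (⊖ φ (c ℕ.* N)))
      ≈⟨ solve 3 (λ o x y → o :- x :+ (x :+ x :* :- y) := o :- x :* y) S.refl 1ˢ (φ c) (φ (c ℕ.* N)) ⟩
    1ˢ ⊕ ⊖ (φ c ⊛ φ (c ℕ.* N))
      ≈⟨ S.+-congˡ {1ˢ} (S.-‿cong (φ-suc N)) ⟨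
    1ˢ ⊕ ⊖ φ (c ℕ.* suc N) ∎
    where
    open ≈-Reasoning
    open S.Solver
    G = ∑ˢ (upTo N) (λ j → φ (c ℕ.* j))
    φ-suc : ∀ j → φ (c ℕ.* suc j) ≈ φ c ⊛ φ (c ℕ.* j)
    φ-suc j = S.trans (S.reflexive (cong φ (ℕ.*-suc c j))) (homo-+ c (c ℕ.* j))

module _ {r : ℕ} (d : ℕ) (a : Vec ℕ r) (0<d : 0 ℕ.< d) (0<a : ∀ i → 0 ℕ.< lookup a i) where
  open RestrictedPartition d a 0<d 0<a

  a*[dj+ε] : ∀ ε j i → lookup a i ℕ.* lookup (zipWith (λ jᵢ εᵢ → d ℕ.* jᵢ ℕ.+ εᵢ) j ε) i
    ≡ lookup a i ℕ.* lookup ε i ℕ.+ d ℕ.* lookup a i ℕ.* lookup j i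
  a*[dj+ε] ε j i = trans (cong (lookup a i ℕ.*_) (lookup-zipWith (λ jᵢ εᵢ → d ℕ.* jᵢ ℕ.+ εᵢ) i j ε))
    (solve 4 (λ d a j e → a :* (d :* j :+ e) := a :* e :+ d :* a :* j) refl d (lookup a i) (lookup j i) (lookup ε i))
    where open Data.Nat.Solver.+-*-Solver

  -- The series `w` stands for 1 / (1 - q^D) and is merely carried along, so it can be `multiples D`
  -- or, with the pole split off, `todd D`.
  prod-factors : ∀ {φ} → IsExponential φ → (N : Vec ℕ r) → ∀ w →
    S.prod (λ i → (1ˢ ⊕ φ (lookup a i)) ⊛ (∑ˢ (upTo (lookup N i)) (λ j → φ (d ℕ.* lookup a i ℕ.* j)) ⊛ w))
    ≈ ∑ˢ (box (replicate r 2)) (λ ε → ∑ˢ (box N) (λ j → φ (weight ε j) ⊛ w ^ r))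
  prod-factors {φ} isExp N w = begin
    S.prod (λ i → (1ˢ ⊕ φ (lookup a i)) ⊛ (G i ⊛ w))
      ≈⟨ S.prod-distrib-* (λ i → 1ˢ ⊕ φ (lookup a i)) (λ i → G i ⊛ w) ⟩
    S.prod (λ i → 1ˢ ⊕ φ (lookup a i)) ⊛ S.prod (λ i → G i ⊛ w)
      ≈⟨ S.*-cong (S.trans (S.prod-cong two-terms) (S.sym (∑ˢ-box (replicate r 2) (λ i y → φ (lookup a i ℕ.* y)))))
           (S.trans (S.prod-distrib-* G (λ _ → w)) (S.*-cong (S.sym (∑ˢ-box N (λ i y → φ (d ℕ.* lookup a i ℕ.* y)))) (S.prod-replicate r))) ⟩
    ∑ˢ (box (replicate r 2)) E ⊛ (∑ˢ (box N) K ⊛ w ^ r)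
      ≈⟨ ∑ˢ-⊛ʳ (box (replicate r 2)) E (∑ˢ (box N) K ⊛ w ^ r) ⟩
    ∑ˢ (box (replicate r 2)) (λ ε → E ε ⊛ (∑ˢ (box N) K ⊛ w ^ r))
      ≈⟨ ∑ˢ-cong (box (replicate r 2)) (λ ε → S.trans (S.*-congˡ {E ε} (∑ˢ-⊛ʳ (box N) K (w ^ r))) (∑ˢ-⊛ˡ (box N) (E ε) (λ j → K j ⊛ w ^ r))) ⟩
    ∑ˢ (box (replicate r 2)) (λ ε → ∑ˢ (box N) (λ j → E ε ⊛ (K j ⊛ w ^ r)))
      ≈⟨ ∑ˢ-cong (box (replicate r 2)) (λ ε → ∑ˢ-cong (box N) (λ j →
           S.trans (S.sym (S.*-assoc (E ε) (K j) (w ^ r))) (S.*-congʳ {w ^ r} (S.sym (φ-weight ε j))))) ⟩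
    ∑ˢ (box (replicate r 2)) (λ ε → ∑ˢ (box N) (λ j → φ (weight ε j) ⊛ w ^ r)) ∎
    where
    open ≈-Reasoning
    open IsExponential isExp
    G : Fin r → Series
    G i = ∑ˢ (upTo (lookup N i)) (λ j → φ (d ℕ.* lookup a i ℕ.* j))
    E K : Vec ℕ r → Series
    E ε = S.prod (λ i → φ (lookup a i ℕ.* lookup ε i))
    K j = S.prod (λ i → φ (d ℕ.* lookup a i ℕ.* lookup j i))
    φ-weight : ∀ ε j → φ (weight ε j) ≈ E ε ⊛ K j
    φ-weight ε j = S.trans (φ-∙ isExp a (zipWith (λ jᵢ εᵢ → d ℕ.* jᵢ ℕ.+ εᵢ) j ε)) (S.trans (S.prod-cong (λ i →
      S.trans (S.reflexive (cong φ (a*[dj+ε] ε j i))) (homo-+ (lookup a i ℕ.* lookup ε i) (d ℕ.* lookup a i ℕ.* lookup j i))))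
      (S.prod-distrib-* (λ i → φ (lookup a i ℕ.* lookup ε i)) (λ i → φ (d ℕ.* lookup a i ℕ.* lookup j i))))
    two-terms : ∀ i → 1ˢ ⊕ φ (lookup a i) ≈ ∑ˢ (upTo (lookup (replicate r 2) i)) (λ y → φ (lookup a i ℕ.* y))
    two-terms i rewrite lookup-replicate i 2 = S.+-cong
      (S.sym (S.trans (S.reflexive (cong φ (ℕ.*-zeroʳ (lookup a i)))) homo-0))
      (S.trans (S.reflexive (cong φ (sym (ℕ.*-identityʳ (lookup a i))))) (S.sym (S.+-identityʳ (φ (lookup a i ℕ.* 1)))))

-- The polynomial part

module _ (D : ℕ) .{{_ : NonZero D}} where
  private
    d = fromℕ D

  -- (1 - e^{-Dt})/t and t/(1 - e^{-Dt})
  quotient : Series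
  quotient k = 1-exp- D (suc k)

  todd : Series
  todd = recip quotient {{1-exp-₁≢0 D}}

  X-⊛-quotient : X ⊛ quotient ≈ 1ˢ ⊕ ⊖ exp (- fromℕ D)
  X-⊛-quotient = pointwise λ { zero → X-⊛-zero quotient ; (suc n) → X-⊛-suc quotient n }

  quotient-⊛-todd : quotient ⊛ todd ≈ 1ˢ
  quotient-⊛-todd = ⊛-recip quotient {{1-exp-₁≢0 D}}

  -- This is the residue of 1 / (1 - e^(-Dt)), the source of the factor 1 / D in the polynomial
  -- part.
  todd-0 : todd 0 ≡ + 1 / D
  todd-0 = fromℕ-cancelˡ D (begin
    d * todd 0        ≡⟨ cong (_* todd 0) (1-exp-₁ D) ⟨
    quotient 0 * todd 0 ≡⟨ ⊛-zero quotient todd ⟨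
    (quotient ⊛ todd) 0 ≡⟨ at quotient-⊛-todd 0 ⟩
    1ℚ                ≡⟨ 1÷-inverseˡ D ⟨
    (+ 1 / D) * d     ≡⟨ ℚ.*-comm (+ 1 / D) d ⟩
    d * (+ 1 / D)     ∎)
    where open ≡-Reasoning

  -- With u for `quotient`, differentiating t u = 1 - e^(-Dt) gives u + t u′ = D e^(-Dt).
  θ-quotient-exp : θ quotient ≈ const d ⊛ exp (- d) ⊕ ⊖ quotient
  θ-quotient-exp = pointwise λ n → let e = exp (- d) (suc n) in begin
    fromℕ n * (0ℚ - e)
      ≡⟨ solve 2 (λ n e → n :* (con 0ℚ :- e) := :- ((con 1ℚ :+ n) :* e) :- (con 0ℚ :- e)) refl (fromℕ n) e ⟩
    - ((1ℚ + fromℕ n) * e) - (0ℚ - e)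
      ≡⟨ cong (λ m → - (m * e) - (0ℚ - e)) (fromℕ-homo-+ 1 n) ⟨
    - (fromℕ (suc n) * e) - (0ℚ - e)
      ≡⟨ cong (λ z → - z - (0ℚ - e)) (exp-suc (- d) n) ⟩
    - (- d * exp (- d) n) - (0ℚ - e)
      ≡⟨ cong (_- (0ℚ - e)) (solve 2 (λ d e → :- (:- d :* e) := d :* e) refl d (exp (- d) n)) ⟩
    d * exp (- d) n - (0ℚ - e)
      ≡⟨ cong (_- (0ℚ - e)) (const-⊛ d (exp (- d)) n) ⟨
    (const d ⊛ exp (- d)) n - (0ℚ - e) ∎
    where
    open ≡-Reasoning
    open +-*-Solver

  -- Replacing the exponential by 1 - t u closes the differential equation in u, so that `θ-todd`
  -- involves only `X` and `todd`.
  θ-quotient : θ quotient ≈ const d ⊛ (1ˢ ⊕ ⊖ (X ⊛ quotient)) ⊕ ⊖ quotient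
  θ-quotient = begin
    θ quotient
      ≈⟨ θ-quotient-exp ⟩
    const d ⊛ exp (- d) ⊕ ⊖ quotient
      ≈⟨ solve 4 (λ d e o v → d :* e :+ :- v := d :* (o :- (o :- e)) :+ :- v) S.refl (const d) (exp (- d)) 1ˢ quotient ⟩
    const d ⊛ (1ˢ ⊕ ⊖ (1ˢ ⊕ ⊖ exp (- d))) ⊕ ⊖ quotient
      ≈⟨ S.+-congʳ {⊖ quotient} (S.*-congˡ {const d} (S.+-congˡ {1ˢ} (S.-‿cong X-⊛-quotient))) ⟨
    const d ⊛ (1ˢ ⊕ ⊖ (X ⊛ quotient)) ⊕ ⊖ quotient ∎
    where
    open ≈-Reasoning
    open S.Solver

  -- In the logarithmic derivative of t / (1 - e^(-Dt)), the term 1 comes from the numerator, and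
  -- the others from e^(-Dt) / (1 - e^(-Dt)) = 1 / (1 - e^(-Dt)) - 1.
  θ-todd : θ todd ≈ todd ⊛ (1ˢ ⊕ const d ⊛ X ⊕ ⊖ (const d ⊛ todd))
  θ-todd = S.trans (θ-inverse quotient-⊛-todd) (S.*-congˡ {todd} (begin
    ⊖ (todd ⊛ θ quotient)
      ≈⟨ S.-‿cong (S.*-congˡ {todd} θ-quotient) ⟩
    ⊖ (todd ⊛ (const d ⊛ (1ˢ ⊕ ⊖ (X ⊛ quotient)) ⊕ ⊖ quotient))
      ≈⟨ solve 5 (λ w d o x v → :- (w :* (d :* (o :- x :* v) :- v)) := v :* w :+ d :* (v :* w :* x) :- d :* (w :* o)) S.refl
           todd (const d) 1ˢ X quotient ⟩
    quotient ⊛ todd ⊕ const d ⊛ (quotient ⊛ todd ⊛ X) ⊕ ⊖ (const d ⊛ (todd ⊛ 1ˢ))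
      ≈⟨ S.+-cong (S.+-cong quotient-⊛-todd (S.*-congˡ {const d} (S.trans (S.*-congʳ {X} quotient-⊛-todd) (S.*-identityˡ X))))
           (S.-‿cong (S.*-congˡ {const d} (S.*-identityʳ todd))) ⟩
    1ˢ ⊕ const d ⊛ X ⊕ ⊖ (const d ⊛ todd) ∎))
    where
    open ≈-Reasoning
    open S.Solver

  θ-exp-todd : ∀ y k → θ (exp y ⊛ todd ^ k) ≈
    X ⊛ ((const y ⊕ const (fromℕ k) ⊛ const d) ⊛ (exp y ⊛ todd ^ k))
    ⊕ const (fromℕ k) ⊛ (exp y ⊛ todd ^ k)
    ⊕ ⊖ (const (fromℕ k) ⊛ const d ⊛ (exp y ⊛ todd ^ suc k))
  θ-exp-todd y k = S.trans (θ-⊛-^ {exp y} {todd} {const y ⊛ X} {1ˢ ⊕ const d ⊛ X ⊕ ⊖ (const d ⊛ todd)} (θ-exp y) θ-todd k)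
    (S.trans
      (solve 8 (λ e w wk y x s o d →
          e :* wk :* (y :* x :+ s :* (o :+ d :* x :- d :* w))
          := x :* ((y :+ s :* d) :* (e :* wk)) :+ s :* (e :* wk :* o) :- s :* d :* (e :* (w :* wk)))
        S.refl (exp y) todd (todd ^ k) (const y) X (const s) 1ˢ (const d))
      (S.+-congʳ {⊖ (const s ⊛ const d ⊛ (exp y ⊛ todd ^ suc k))} (S.+-congˡ {X ⊛ ((const y ⊕ const s ⊛ const d) ⊛ H)}
        (S.*-congˡ {const s} (S.*-identityʳ H)))))
    where
    open S.Solver
    s = fromℕ k
    H = exp y ⊛ todd ^ k

  -- The residue at 0 of the derivative of e^{yt} (1 - e^{-Dt})^{-k-1} vanishes.
  exp-todd-step : ∀ y k →
    fromℕ (suc k) * d * (exp y ⊛ todd ^ suc (suc k)) (suc k)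
    ≡ (y + fromℕ (suc k) * d) * (exp y ⊛ todd ^ suc k) k
  exp-todd-step y k = begin
    u
      ≡⟨ solve 3 (λ u v x → u := v :+ x :- (v :+ x :- u)) refl u v x ⟩
    v + x - (v + x - u)
      ≡⟨ cong (λ z → v + x - z) coefficient ⟨
    v + x - x
      ≡⟨ solve 2 (λ v x → v :+ x :- x := v) refl v x ⟩
    v ∎
    where
    open ≡-Reasoning
    open +-*-Solver
    s = fromℕ (suc k)
    H₁ = exp y ⊛ todd ^ suc k
    H₂ = exp y ⊛ todd ^ suc (suc k)
    u = s * d * H₂ (suc k)
    v = (y + s * d) * H₁ k
    x = s * H₁ (suc k)
    -- In degree k + 1 the operator `θ` multiplies by k + 1, which is also the exponent of `todd`.
    -- Hence `x` stands on both sides and cancels, and u = v remains.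
    coefficient : x ≡ v + x - u
    coefficient = trans (at (θ-exp-todd y (suc k)) (suc k)) (cong₂ _-_ (cong₂ _+_
      (trans (X-⊛-suc ((const y ⊕ const s ⊛ const d) ⊛ H₁) k)
        (trans (⊛-distribʳ H₁ (const y) (const s ⊛ const d) k)
          (trans (cong₂ _+_ (const-⊛ y H₁ k) (const-const-⊛ s d H₁ k))
            (sym (ℚ.*-distribʳ-+ (H₁ k) y (s * d))))))
      (const-⊛ s H₁ (suc k)))
      (const-const-⊛ s d H₂ (suc k)))

  exp-todd-coefficient : ∀ y k → (exp y ⊛ todd ^ suc k) k
    ≡ (1ℚ ÷ℕ k !) {{k !≢0}} * (∏[ ℓ ← applyUpTo suc k ] (y ÷ℕ D + fromℕ ℓ)) * (+ 1 / D)
  -- Because 1 / (1 - e^(-Dt))^k = t^(-k) `todd`^k, the residue hₖ is the coefficient of index k -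
  -- 1.
  exp-todd-coefficient y k = trans (rising-product (λ k → (exp y ⊛ todd ^ k) (k ∸ 1)) y D (exp-todd-step y) k)
    (cong ((1ℚ ÷ℕ k !) {{k !≢0}} * (∏[ ℓ ← applyUpTo suc k ] (y ÷ℕ D + fromℕ ℓ)) *_) (begin
      (exp y ⊛ (todd ⊛ 1ˢ)) 0     ≡⟨ ⊛-zero (exp y) (todd ⊛ 1ˢ) ⟩
      1ℚ * (todd ⊛ 1ˢ) 0          ≡⟨ ℚ.*-identityˡ ((todd ⊛ 1ˢ) 0) ⟩
      (todd ⊛ 1ˢ) 0               ≡⟨ at (S.*-identityʳ todd) 0 ⟩
      todd 0                      ≡⟨ todd-0 ⟩
      + 1 / D                     ∎))
    where open ≡-Reasoning

-- This is 1 / (1 - q^c) = G / (1 - q^(cN)) multiplied by t. The geometric sum is divided by t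
-- through `X-cancelˡ` before reciprocals are taken.
recip-quotient : ∀ c N .{{_ : NonZero c}} .{{_ : NonZero (c ℕ.* N)}} →
  todd c ≈ ∑ˢ (upTo N) (λ j → exp (- fromℕ (c ℕ.* j))) ⊛ todd (c ℕ.* N)
recip-quotient c N = begin
  todd c
    ≈⟨ S.*-identityʳ (todd c) ⟨
  todd c ⊛ 1ˢ
    ≈⟨ S.*-congˡ {todd c} (quotient-⊛-todd (c ℕ.* N)) ⟨
  todd c ⊛ (quotient (c ℕ.* N) ⊛ todd (c ℕ.* N))
    ≈⟨ S.*-congˡ {todd c} (S.*-congʳ {todd (c ℕ.* N)} quotient-⊛-G) ⟨
  todd c ⊛ (quotient c ⊛ G ⊛ todd (c ℕ.* N))
    ≈⟨ solve 4 (λ t q g w → t :* (q :* g :* w) := q :* t :* (g :* w)) S.refl (todd c) (quotient c) G (todd (c ℕ.* N)) ⟩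
  quotient c ⊛ todd c ⊛ (G ⊛ todd (c ℕ.* N))
    ≈⟨ S.*-congʳ {G ⊛ todd (c ℕ.* N)} (quotient-⊛-todd c) ⟩
  1ˢ ⊛ (G ⊛ todd (c ℕ.* N))
    ≈⟨ S.*-identityˡ (G ⊛ todd (c ℕ.* N)) ⟩
  G ⊛ todd (c ℕ.* N) ∎
  where
  open ≈-Reasoning
  open S.Solver
  G = ∑ˢ (upTo N) (λ j → exp (- fromℕ (c ℕ.* j)))
  quotient-⊛-G : quotient c ⊛ G ≈ quotient (c ℕ.* N)
  quotient-⊛-G = X-cancelˡ (S.trans (S.sym (S.*-assoc X (quotient c) G))
    (S.trans (S.*-congʳ {G} (X-⊛-quotient c))
      (S.trans (geometric-sum exp-isExponential c N) (S.sym (X-⊛-quotient (c ℕ.* N))))))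

-- The pole of a product over `Fin r` is r only by induction, while `coeff` computes only at a known
-- pole order; the equation bridges the two.
coeff-[-1] : ∀ L k → pole L ≡ suc k → coeff L -[1+ 0 ] ≡ series L k
coeff-[-1] (t^- .(suc k) · f) k refl = refl

⊠-product : ∀ {r} → (Fin r → Laurent) → Laurent
⊠-product g = Vec.foldr′ _⊠_ (↑ 1ˢ) (tabulate g)

pole-⊠-product : ∀ {r} (g : Fin r → Laurent) → (∀ i → pole (g i) ≡ 1) → pole (⊠-product g) ≡ r
pole-⊠-product {zero}  g p = refl
pole-⊠-product {suc r} g p = cong₂ ℕ._+_ (p zero) (pole-⊠-product (g ∘ suc) (p ∘ suc))

series-⊠-product : ∀ {r} (g : Fin r → Laurent) → series (⊠-product g) ≈ S.prod (series ∘ g)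
series-⊠-product {zero}  g = S.refl
series-⊠-product {suc r} g = S.*-congˡ {series (g zero)} (series-⊠-product (g ∘ suc))

1÷-* : ∀ m n .{{_ : NonZero m}} .{{_ : NonZero n}} → (1ℚ ÷ℕ (m ℕ.* n)) {{m*n≢0 m n}} ≡ 1ℚ ÷ℕ n * (+ 1 / m)
1÷-* m n = fromℕ-cancelˡ (m ℕ.* n) {{m*n≢0 m n}} (begin
  fromℕ (m ℕ.* n) * (1ℚ * u)
    ≡⟨ solve 2 (λ x u → x :* (con 1ℚ :* u) := u :* x) refl (fromℕ (m ℕ.* n)) u ⟩
  u * fromℕ (m ℕ.* n)
    ≡⟨ 1÷-inverseˡ (m ℕ.* n) {{m*n≢0 m n}} ⟩
  1ℚ * 1ℚ
    ≡⟨ cong₂ _*_ (1÷-inverseˡ m) (1÷-inverseˡ n) ⟨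
  (+ 1 / m) * fromℕ m * ((+ 1 / n) * fromℕ n)
    ≡⟨ solve 4 (λ i m j n → i :* m :* (j :* n) := m :* n :* (con 1ℚ :* j :* i)) refl (+ 1 / m) (fromℕ m) (+ 1 / n) (fromℕ n) ⟩
  fromℕ m * fromℕ n * (1ℚ * (+ 1 / n) * (+ 1 / m))
    ≡⟨ cong (_* (1ℚ * (+ 1 / n) * (+ 1 / m))) (fromℕ-homo-* m n) ⟨
  fromℕ (m ℕ.* n) * (1ℚ * (+ 1 / n) * (+ 1 / m)) ∎)
  where
  open ≡-Reasoning
  open +-*-Solver
  u = (+ 1 / (m ℕ.* n)) {{m*n≢0 m n}}

module _ {r : ℕ} (d : ℕ) (a : Vec ℕ r) (0<d : 0 ℕ.< d) (0<a : ∀ i → 0 ℕ.< lookup a i) where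
  open RestrictedPartition d a 0<d 0<a

  da∣D : ∀ i → d ℕ.* lookup a i ∣ D
  da∣D = go a
    where
    go : ∀ {s} (b : Vec ℕ s) i → d ℕ.* lookup b i ∣ Vec.foldr′ lcm 1 (Vec.map (d ℕ.*_) b)
    go (x ∷ b) zero    = m∣lcm[m,n] (d ℕ.* x) _
    go (x ∷ b) (suc i) = ∣-trans (go b i) (n∣lcm[m,n] (d ℕ.* x) _)

  da*jBound : ∀ i → d ℕ.* lookup a i ℕ.* lookup jBound i ≡ D
  da*jBound i = trans (cong (d ℕ.* lookup a i ℕ.*_) (lookup∘tabulate _ i))
    (m*[n/m]≡n {{d*a≢0 i}} (da∣D i))

  series-factor : ∀ i → series (factor i) ≈
    (1ˢ ⊕ exp (- fromℕ (lookup a i))) ⊛ (∑ˢ (upTo (lookup jBound i)) (λ j → exp (- fromℕ (d ℕ.* lookup a i ℕ.* j))) ⊛ todd D {{D≢0}})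
  series-factor i = S.*-congˡ {1ˢ ⊕ exp (- fromℕ (lookup a i))}
    (S.trans (recip-quotient c N {{d*a≢0 i}} {{cN≢0}}) (S.*-congˡ {∑ˢ (upTo N) (λ j → exp (- fromℕ (c ℕ.* j)))}
      (todd-cong (da*jBound i) {{cN≢0}})))
    where
    c = d ℕ.* lookup a i
    N = lookup jBound i
    cN≢0 : NonZero (c ℕ.* N)
    cN≢0 = subst NonZero (sym (da*jBound i)) D≢0
    todd-cong : ∀ {m} (eq : m ≡ D) .{{_ : NonZero m}} → todd m ≈ todd D {{D≢0}}
    todd-cong refl = S.refl

  polynomial-part : ∀ k → r ≡ suc k → ∀ x → P x ≡
    (1ℚ ÷ℕ (D ℕ.* k !)) {{m*n≢0 D (k !) {{D≢0}} {{k !≢0}}}} *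
    (∑[ ε ← box (replicate r 2) ] ∑[ j ← box jBound ]
     ∏[ ℓ ← applyUpTo suc k ] ((((x - fromℕ (weight ε j)) ÷ℕ D) {{D≢0}}) + fromℕ ℓ))
  polynomial-part k refl x = begin
    P x
      ≡⟨ coeff-[-1] (generating x) k (pole-⊠-product factor (λ _ → refl)) ⟩
    (exp x ⊛ series (⊠-product factor)) k
      ≡⟨ at expansion k ⟩
    (∑[ ε ← box (replicate r 2) ] ∑[ j ← box jBound ] (exp (x - fromℕ (weight ε j)) ⊛ todd D ^ r) k)
      ≡⟨ ∑-cong (box (replicate r 2)) (λ ε → ∑-cong (box jBound) (λ j → coefficient (x - fromℕ (weight ε j)))) ⟩
    (∑[ ε ← box (replicate r 2) ] ∑[ j ← box jBound ] (c * Π ε j))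
      ≡⟨ ∑-cong (box (replicate r 2)) (λ ε → sym (∑-distribˡ c (box jBound) (Π ε))) ⟩
    (∑[ ε ← box (replicate r 2) ] (c * (∑[ j ← box jBound ] Π ε j)))
      ≡⟨ ∑-distribˡ c (box (replicate r 2)) (λ ε → ∑[ j ← box jBound ] Π ε j) ⟨
    c * (∑[ ε ← box (replicate r 2) ] ∑[ j ← box jBound ] Π ε j) ∎
    where
    instance
      _ = D≢0
      _ = k !≢0
      _ = m*n≢0 D (k !)
    open ≡-Reasoning
    open +-*-Solver
    c = 1ℚ ÷ℕ (D ℕ.* k !)
    Π : Vec ℕ r → Vec ℕ r → ℚ
    Π ε j = ∏[ ℓ ← applyUpTo suc k ] ((x - fromℕ (weight ε j)) ÷ℕ D + fromℕ ℓ)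
    coefficient : ∀ y → (exp y ⊛ todd D ^ suc k) k ≡ c * (∏[ ℓ ← applyUpTo suc k ] (y ÷ℕ D + fromℕ ℓ))
    coefficient y = trans (exp-todd-coefficient D y k)
      (trans (solve 3 (λ u p i → u :* p :* i := u :* i :* p) refl (1ℚ ÷ℕ k !) Πy (+ 1 / D))
        (cong (_* Πy) (sym (1÷-* D (k !)))))
      where Πy = ∏[ ℓ ← applyUpTo suc k ] (y ÷ℕ D + fromℕ ℓ)
    W = todd D
    expansion : exp x ⊛ series (⊠-product factor) ≈
      ∑ˢ (box (replicate r 2)) (λ ε → ∑ˢ (box jBound) (λ j → exp (x - fromℕ (weight ε j)) ⊛ W ^ r))
    expansion = S.trans (S.*-congˡ {exp x} (S.trans (series-⊠-product factor)
        (S.trans (S.prod-cong series-factor) (prod-factors d a 0<d 0<a exp-isExponential jBound W))))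
      (S.trans (∑ˢ-⊛ˡ (box (replicate r 2)) (exp x) (λ ε → ∑ˢ (box jBound) (λ j → exp (- fromℕ (weight ε j)) ⊛ W ^ r)))
        (∑ˢ-cong (box (replicate r 2)) λ ε →
          S.trans (∑ˢ-⊛ˡ (box jBound) (exp x) (λ j → exp (- fromℕ (weight ε j)) ⊛ W ^ r))
            (∑ˢ-cong (box jBound) λ j →
              S.trans (S.sym (S.*-assoc (exp x) (exp (- fromℕ (weight ε j))) (W ^ r)))
                (S.*-congʳ {W ^ r} (S.sym (exp-homo-+ x (- fromℕ (weight ε j))))))))

-- The counting function

⟪⟫-yes : ∀ {P : Set} (P? : Dec P) → P → ⟪ P? ⟫ ≡ 1ℚ
⟪⟫-yes (yes _) _ = refl
⟪⟫-yes (no ¬p) p = contradiction p ¬p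

⟪⟫-no : ∀ {P : Set} (P? : Dec P) → ¬ P → ⟪ P? ⟫ ≡ 0ℚ
⟪⟫-no (yes p) ¬p = contradiction p ¬p
⟪⟫-no (no _)  _  = refl

⟪⟫-cong : ∀ {P Q : Set} (P? : Dec P) (Q? : Dec Q) → (P → Q) → (Q → P) → ⟪ P? ⟫ ≡ ⟪ Q? ⟫
⟪⟫-cong (yes p) Q? f g = sym (⟪⟫-yes Q? (f p))
⟪⟫-cong (no ¬p) Q? f g = sym (⟪⟫-no Q? (¬p ∘ g))

⟪⟫-× : ∀ {P Q R : Set} (P? : Dec P) (Q? : Dec Q) (R? : Dec R) →
  (R → P × Q) → (P → Q → R) → ⟪ R? ⟫ ≡ ⟪ P? ⟫ * ⟪ Q? ⟫
⟪⟫-× (yes p) Q? R? f g = trans (⟪⟫-cong R? Q? (proj₂ ∘ f) (g p)) (sym (ℚ.*-identityˡ ⟪ Q? ⟫))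
⟪⟫-× (no ¬p) Q? R? f g = trans (⟪⟫-no R? (¬p ∘ proj₁ ∘ f)) (sym (ℚ.*-zeroˡ ⟪ Q? ⟫))

X^-⊛-+ : ∀ m f n → (X ^ m ⊛ f) (m ℕ.+ n) ≡ f n
X^-⊛-+ zero    f n = ⊛-identityˡ f n
X^-⊛-+ (suc m) f n = trans (⊛-assoc X (X ^ m) f (suc m ℕ.+ n))
  (trans (X-⊛-suc (X ^ m ⊛ f) (m ℕ.+ n)) (X^-⊛-+ m f n))

X^-⊛-< : ∀ m f {n} → n ℕ.< m → (X ^ m ⊛ f) n ≡ 0ℚ
X^-⊛-< (suc m) f {zero}  _         = trans (⊛-assoc X (X ^ m) f 0) (X-⊛-zero (X ^ m ⊛ f))
X^-⊛-< (suc m) f {suc n} (s≤s n<m) = trans (⊛-assoc X (X ^ m) f (suc n))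
  (trans (X-⊛-suc (X ^ m ⊛ f) n) (X^-⊛-< m f n<m))

-- In the case `above` the index has the literal form m + k, to which `X^-⊛-+` applies.
data Split (m : ℕ) : ℕ → Set where
  below : ∀ {n} → n ℕ.< m → Split m n
  above : ∀ k → Split m (m ℕ.+ k)

split : ∀ m n → Split m n
split m n with n ℕ.<? m
... | yes n<m = below n<m
... | no  n≮m = subst (Split m) (ℕ.m+[n∸m]≡n (ℕ.≮⇒≥ n≮m)) (above (n ∸ m))

X^-coefficient : ∀ m n → (X ^ m) n ≡ ⟪ m ℕ.≟ n ⟫
X^-coefficient m n = trans (sym (at (S.*-identityʳ (X ^ m)) n)) (go n (split m n))
  where
  go : ∀ n → Split m n → (X ^ m ⊛ 1ˢ) n ≡ ⟪ m ℕ.≟ n ⟫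
  go n (below n<m) = trans (X^-⊛-< m 1ˢ n<m) (sym (⟪⟫-no (m ℕ.≟ n) (ℕ.>⇒≢ n<m)))
  go _ (above zero) = trans (X^-⊛-+ m 1ˢ 0) (sym (⟪⟫-yes (m ℕ.≟ (m ℕ.+ 0)) (sym (ℕ.+-identityʳ m))))
  go _ (above (suc k)) = trans (X^-⊛-+ m 1ˢ (suc k)) (sym (⟪⟫-no (m ℕ.≟ (m ℕ.+ suc k)) (ℕ.m≢1+m+n m ∘ (λ eq → trans eq (ℕ.+-suc m k)))))

θ-X^ : ∀ m → θ (X ^ m) ≈ X ^ m ⊛ const (fromℕ m)
θ-X^ m = S.trans (θ-^ {X} {1ˢ} (S.trans θ-X (S.sym (S.*-identityʳ X))) m)
  (S.*-congˡ {X ^ m} (S.*-identityʳ (const (fromℕ m))))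

∏-zero : ∀ {A : Set} {xs : List A} {x} f → x ∈ xs → f x ≡ 0ℚ → ∏ xs f ≡ 0ℚ
∏-zero {xs = _ ∷ xs} f (here refl) fx≡0 = trans (cong (_* ∏ xs f) fx≡0) (ℚ.*-zeroˡ (∏ xs f))
∏-zero {xs = y ∷ xs} f (there x∈xs) fx≡0 = trans (cong (f y *_) (∏-zero f x∈xs fx≡0)) (ℚ.*-zeroʳ (f y))

module _ (D : ℕ) .{{_ : NonZero D}} where
  private
    d = fromℕ D

  -- The series 1 / (1 - t^D) by its coefficients; these become the congruence condition of the
  -- formula.
  multiples : Series
  multiples n = ⟪ D ∣? n ⟫

  -- Multiplication by t^D shifts the multiples of D by one period, so everything cancels from
  -- degree D on; below D the only multiple is 0.
  [1-X^D]-⊛-multiples : (1ˢ ⊕ ⊖ X ^ D) ⊛ multiples ≈ 1ˢ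
  [1-X^D]-⊛-multiples = S.trans (S.distribʳ multiples 1ˢ (⊖ X ^ D))
    (S.trans (S.+-cong (S.*-identityˡ multiples)
      (solve 2 (λ x m → :- x :* m := :- (x :* m)) S.refl (X ^ D) multiples))
      (pointwise λ n → go n (split D n)))
    where
    open S.Solver
    low : ∀ n → n ℕ.< D → multiples n ≡ 1ˢ n
    low zero    _     = ⟪⟫-yes (D ∣? 0) (D ∣0)
    low (suc n) 1+n<D = ⟪⟫-no (D ∣? suc n) (>⇒∤ 1+n<D)
    go : ∀ n → Split D n → multiples n - (X ^ D ⊛ multiples) n ≡ 1ˢ n
    go n (below n<D) = trans (cong₂ _-_ (low n n<D) (X^-⊛-< D multiples n<D)) (ℚ.+-identityʳ (1ˢ n))
    go _ (above k) = begin
      multiples (D ℕ.+ k) - (X ^ D ⊛ multiples) (D ℕ.+ k)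
        ≡⟨ cong₂ _-_ (⟪⟫-cong (D ∣? (D ℕ.+ k)) (D ∣? k) (λ p → ∣m+n∣m⇒∣n p ∣-refl) (∣m∣n⇒∣m+n ∣-refl)) (X^-⊛-+ D multiples k) ⟩
      multiples k - multiples k
        ≡⟨ ℚ.+-inverseʳ (multiples k) ⟩
      0ℚ
        ≡⟨ 1ˢ-+ D k ⟨
      1ˢ (D ℕ.+ k) ∎
      where
      open ≡-Reasoning
      1ˢ-+ : ∀ m .{{_ : NonZero m}} k → 1ˢ (m ℕ.+ k) ≡ 0ℚ
      1ˢ-+ (suc m) k = refl

  -- The logarithmic derivative of 1 / (1 - t^D) is D t^D / (1 - t^D), rewritten as D / (1 - t^D) -
  -- D to eliminate t^D.
  θ-multiples : θ multiples ≈ multiples ⊛ (const d ⊛ multiples ⊕ ⊖ const d)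
  θ-multiples = S.trans (θ-inverse [1-X^D]-⊛-multiples) (S.*-congˡ {multiples} (begin
    ⊖ (multiples ⊛ θ (1ˢ ⊕ ⊖ X ^ D))
      ≈⟨ S.-‿cong (S.*-congˡ {multiples} (S.trans (θ-⊕ 1ˢ (⊖ X ^ D)) (S.+-cong θ-1 (θ-⊖ (X ^ D))))) ⟩
    ⊖ (multiples ⊛ (0ˢ ⊕ ⊖ θ (X ^ D)))
      ≈⟨ S.-‿cong (S.*-congˡ {multiples} (S.trans (S.+-identityˡ (⊖ θ (X ^ D))) (S.-‿cong (θ-X^ D)))) ⟩
    ⊖ (multiples ⊛ (⊖ (X ^ D ⊛ const d)))
      ≈⟨ solve 4 (λ m x d o → :- (m :* :- (x :* d)) := d :* (m :* o) :- d :* ((o :- x) :* m)) S.refl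
           multiples (X ^ D) (const d) 1ˢ ⟩
    const d ⊛ (multiples ⊛ 1ˢ) ⊕ ⊖ (const d ⊛ ((1ˢ ⊕ ⊖ X ^ D) ⊛ multiples))
      ≈⟨ S.+-cong (S.*-congˡ {const d} (S.*-identityʳ multiples))
           (S.-‿cong (S.trans (S.*-congˡ {const d} [1-X^D]-⊛-multiples) (S.*-identityʳ (const d)))) ⟩
    const d ⊛ multiples ⊕ ⊖ const d ∎))
    where
    open ≈-Reasoning
    open S.Solver
    θ-⊖ : ∀ f → θ (⊖ f) ≈ ⊖ θ f
    θ-⊖ f = pointwise λ n → sym (ℚ.neg-distribʳ-* (fromℕ n) (f n))

  θ-X^-multiples : ∀ w k → θ (X ^ w ⊛ multiples ^ k) ≈
    const (fromℕ w) ⊛ (X ^ w ⊛ multiples ^ k)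
    ⊕ const (fromℕ k) ⊛ const d ⊛ (X ^ w ⊛ multiples ^ suc k)
    ⊕ ⊖ (const (fromℕ k) ⊛ const d ⊛ (X ^ w ⊛ multiples ^ k))
  θ-X^-multiples w k = S.trans
    (θ-⊛-^ {X ^ w} {multiples} {const (fromℕ w)} {const d ⊛ multiples ⊕ ⊖ const d} (θ-X^ w) θ-multiples k)
    (solve 6 (λ e m mk w s d → e :* mk :* (w :+ s :* (d :* m :- d))
        := w :* (e :* mk) :+ s :* d :* (e :* (m :* mk)) :- s :* d :* (e :* mk))
      S.refl (X ^ w) multiples (multiples ^ k) (const (fromℕ w)) (const (fromℕ k)) (const d))
    where open S.Solver

  X^-multiples-step : ∀ w n k →
    fromℕ (suc k) * d * (X ^ w ⊛ multiples ^ suc (suc k)) n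
    ≡ (fromℕ n - fromℕ w + fromℕ (suc k) * d) * (X ^ w ⊛ multiples ^ suc k) n
  X^-multiples-step w n k = begin
    s * d * H₂ n
      ≡⟨ solve 4 (λ u x w t → u := w :* x :+ u :- t :* x :- w :* x :+ t :* x) refl (s * d * H₂ n) (H₁ n) (fromℕ w) (s * d) ⟩
    fromℕ w * H₁ n + s * d * H₂ n - s * d * H₁ n - fromℕ w * H₁ n + s * d * H₁ n
      ≡⟨ cong (λ z → z - fromℕ w * H₁ n + s * d * H₁ n) coefficient ⟨
    fromℕ n * H₁ n - fromℕ w * H₁ n + s * d * H₁ n
      ≡⟨ solve 4 (λ n x w t → n :* x :- w :* x :+ t :* x := (n :- w :+ t) :* x) refl (fromℕ n) (H₁ n) (fromℕ w) (s * d) ⟩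
    (fromℕ n - fromℕ w + s * d) * H₁ n ∎
    where
    open ≡-Reasoning
    open +-*-Solver
    s = fromℕ (suc k)
    H₁ = X ^ w ⊛ multiples ^ suc k
    H₂ = X ^ w ⊛ multiples ^ suc (suc k)
    coefficient : fromℕ n * H₁ n ≡ fromℕ w * H₁ n + s * d * H₂ n - s * d * H₁ n
    coefficient = trans (at (θ-X^-multiples w (suc k)) n)
      (cong₂ _-_ (cong₂ _+_ (const-⊛ (fromℕ w) H₁ n) (const-const-⊛ s d H₂ n)) (const-const-⊛ s d H₁ n))

  -- For w > n the left-hand side is 0; if D ∣ w - n, so is the product, since w - n < (k + 1) D.
  X^-multiples-coefficient : ∀ w n k → w ℕ.< suc k ℕ.* D → (X ^ w ⊛ multiples ^ suc k) n
    ≡ (1ℚ ÷ℕ k !) {{k !≢0}} *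
      (⟪ w ≡? n [mod D ] ⟫ * (∏[ ℓ ← applyUpTo suc k ] ((fromℕ n - fromℕ w) ÷ℕ D + fromℕ ℓ)))
  X^-multiples-coefficient w n k w<[1+k]D = begin
    (X ^ w ⊛ multiples ^ suc k) n
      ≡⟨ rising-product (λ k → (X ^ w ⊛ multiples ^ k) n) (fromℕ n - fromℕ w) D (X^-multiples-step w n) k ⟩
    c * Π n * (X ^ w ⊛ (multiples ⊛ 1ˢ)) n
      ≡⟨ cong (c * Π n *_) (at (S.*-congˡ {X ^ w} (S.*-identityʳ multiples)) n) ⟩
    c * Π n * (X ^ w ⊛ multiples) n
      ≡⟨ ℚ.*-assoc c (Π n) _ ⟩
    c * (Π n * (X ^ w ⊛ multiples) n)
      ≡⟨ cong (c *_) (trans (go n (split w n)) (ℚ.*-comm (Π n) ⟪ w ≡? n [mod D ] ⟫)) ⟩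
    c * (⟪ w ≡? n [mod D ] ⟫ * Π n) ∎
    where
    open ≡-Reasoning
    open +-*-Solver
    c = (1ℚ ÷ℕ k !) {{k !≢0}}
    factor : ℕ → ℕ → ℚ
    factor n ℓ = (fromℕ n - fromℕ w) ÷ℕ D + fromℕ ℓ
    Π : ℕ → ℚ
    Π n = ∏ (applyUpTo suc k) (factor n)
    go : ∀ n → Split w n → Π n * (X ^ w ⊛ multiples) n ≡ Π n * ⟪ w ≡? n [mod D ] ⟫
    go _ (above m) = cong (Π (w ℕ.+ m) *_) (trans (X^-⊛-+ w multiples m)
      (⟪⟫-cong (D ∣? m) (D ∣? ∣ w - w ℕ.+ m ∣)
        (subst (D ∣_) (sym (ℕ.∣m-m+n∣≡n w m))) (subst (D ∣_) (ℕ.∣m-m+n∣≡n w m))))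
    go n (below n<w) with w ≡? n [mod D ]
    ... | no  _ = cong (Π n *_) (X^-⊛-< w multiples n<w)
    ... | yes (divides q ∣w-n∣≡qD) = trans (trans (cong (Π n *_) (X^-⊛-< w multiples n<w)) (ℚ.*-zeroʳ (Π n)))
          (sym (trans (ℚ.*-identityʳ (Π n)) (Π≡0 q w≡n+qD)))
      where
      w≡n+qD : w ≡ n ℕ.+ q ℕ.* D
      w≡n+qD = trans (sym (ℕ.m+[n∸m]≡n (<⇒≤ n<w)))
        (cong (n ℕ.+_) (trans (sym (ℕ.m≤n⇒∣n-m∣≡n∸m (<⇒≤ n<w))) ∣w-n∣≡qD))
      Π≡0 : ∀ q → w ≡ n ℕ.+ q ℕ.* D → Π n ≡ 0ℚ
      Π≡0 zero    w≡n   = contradiction (trans w≡n (ℕ.+-identityʳ n)) (ℕ.>⇒≢ n<w)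
      -- With w - n = (i + 1) D, the factor for ℓ = i + 1 is zero.
      Π≡0 (suc i) w≡n+qD = ∏-zero (factor n) (∈-applyUpTo⁺ suc i<k) (begin
        (fromℕ n - fromℕ w) * (+ 1 / D) + fromℕ (suc i)
          ≡⟨ cong (λ w → (fromℕ n - w) * (+ 1 / D) + fromℕ (suc i))
               (trans (cong fromℕ w≡n+qD) (trans (fromℕ-homo-+ n (suc i ℕ.* D)) (cong (λ z → fromℕ n + z) (fromℕ-homo-* (suc i) D)))) ⟩
        (fromℕ n - (fromℕ n + fromℕ (suc i) * d)) * (+ 1 / D) + fromℕ (suc i)
          ≡⟨ solve 4 (λ n q d u → (n :- (n :+ q :* d)) :* u :+ q := q :- q :* (u :* d)) refl
               (fromℕ n) (fromℕ (suc i)) d (+ 1 / D) ⟩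
        fromℕ (suc i) - fromℕ (suc i) * ((+ 1 / D) * d)
          ≡⟨ cong (λ z → fromℕ (suc i) - fromℕ (suc i) * z) (1÷-inverseˡ D) ⟩
        fromℕ (suc i) - fromℕ (suc i) * 1ℚ
          ≡⟨ solve 1 (λ q → q :- q :* con 1ℚ := con 0ℚ) refl (fromℕ (suc i)) ⟩
        0ℚ ∎)
        where
        i<k : i ℕ.< k
        -- From (i + 1) D ≤ w < (k + 1) D it follows that ℓ = i + 1 lies in the range 1, ..., k of
        -- the product.
        i<k = ℕ.s<s⁻¹ (ℕ.*-cancelʳ-< D (suc i) (suc k)
          (ℕ.≤-<-trans (ℕ.m≤n+m (suc i ℕ.* D) n) (subst (ℕ._< suc k ℕ.* D) w≡n+qD w<[1+k]D)))

-- Truncated generating functions of the individual parts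

prod-local : ∀ {r} (f g : Fin r → Series) n → (∀ i k → k ℕ.≤ n → f i k ≡ g i k) →
  ∀ k → k ℕ.≤ n → S.prod f k ≡ S.prod g k
prod-local {zero}  f g n p k k≤n = refl
prod-local {suc r} f g n p k k≤n = ⊛-local k (λ l l≤k → p zero l (ℕ.≤-trans l≤k k≤n))
  (λ l l≤k → prod-local (f ∘ suc) (g ∘ suc) n (p ∘ suc) l (ℕ.≤-trans l≤k k≤n))

prod-const-⟪⟫ : ∀ {r} {P : ℕ → Set} (P? : ∀ y → Dec (P y)) (x : Vec ℕ r) →
  S.prod (λ i → const ⟪ P? (lookup x i) ⟫) ≈ const ⟪ all? P? x ⟫
prod-const-⟪⟫ P? []       = S.sym const-1
prod-const-⟪⟫ P? (y ∷ x) = S.trans (S.*-congˡ {const ⟪ P? y ⟫} (prod-const-⟪⟫ P? x))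
  (pointwise λ n → trans (const-⊛ ⟪ P? y ⟫ (const ⟪ all? P? x ⟫) n)
    (trans (scale-const n) (cong (λ c → const c n) (sym (⟪⟫-× (P? y) (all? P? x) (all? P? (y ∷ x)) (λ { (p ∷ ps) → p , ps }) _∷_)))))
  where
  scale-const : ∀ n → ⟪ P? y ⟫ * const ⟪ all? P? x ⟫ n ≡ const (⟪ P? y ⟫ * ⟪ all? P? x ⟫) n
  scale-const zero    = refl
  scale-const (suc n) = ℚ.*-zeroʳ ⟪ P? y ⟫

module _ (d : ℕ) where
  ZeroOne : ℕ → Set
  ZeroOne y = y ≡ 0 [mod d ] ⊎ y ≡ 1 [mod d ]

  zeroOne? : ∀ y → Dec (ZeroOne y)
  zeroOne? y = (y ≡? 0 [mod d ]) ⊎-dec (y ≡? 1 [mod d ])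

  term : ℕ → ℕ → Series
  term a y = const ⟪ zeroOne? y ⟫ ⊛ X ^ (a ℕ.* y)

  -- The cut at `b` reflects the finite box searched by `solutions`; for positive `a` the
  -- coefficients below degree `b` are those of the full series.
  truncated : ℕ → ℕ → Series
  truncated a b = ∑ˢ (upTo b) (term a)

module _ (d′ : ℕ) where
  private
    d = 2 ℕ.+ d′

  -- The distance from y to 1 is y - 1 only for positive y, so y = 0 is treated apart; there
  -- `ZeroOne` holds outright.
  zeroOne-+⁻ : ∀ y → ZeroOne d (d ℕ.+ y) → ZeroOne d y
  zeroOne-+⁻ zero    _        = inj₁ (d ∣0)
  zeroOne-+⁻ (suc y) (inj₁ p) = inj₁ (∣m+n∣m⇒∣n p ∣-refl)
  zeroOne-+⁻ (suc y) (inj₂ p) = inj₂ (subst (d ∣_) (sym (ℕ.∣-∣-identityʳ y))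
    (∣m+n∣m⇒∣n (subst (d ∣_) (ℕ.+-suc (suc d′) y) p) ∣-refl))

  zeroOne-+⁺ : ∀ y → ZeroOne d y → ZeroOne d (d ℕ.+ y)
  zeroOne-+⁺ zero    _        = inj₁ (∣m∣n⇒∣m+n ∣-refl (d ∣0))
  zeroOne-+⁺ (suc y) (inj₁ p) = inj₁ (∣m∣n⇒∣m+n ∣-refl p)
  zeroOne-+⁺ (suc y) (inj₂ p) = inj₂ (subst (d ∣_) (sym (ℕ.+-suc (suc d′) y))
    (∣m∣n⇒∣m+n ∣-refl (subst (d ∣_) (ℕ.∣-∣-identityʳ y) p)))

  ¬zeroOne : ∀ y → y ℕ.< d′ → ¬ ZeroOne d (2 ℕ.+ y)
  ¬zeroOne y y<d′ (inj₁ p) = >⇒∤ (s≤s (s≤s y<d′)) p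
  ¬zeroOne y y<d′ (inj₂ p) = >⇒∤ (s≤s (ℕ.m≤n⇒m≤1+n y<d′)) p

  module _ (a : ℕ) where
    term-zeroOne : ∀ y → ZeroOne d y → term d a y ≈ X ^ (a ℕ.* y)
    term-zeroOne y p = S.trans (S.*-congʳ {X ^ (a ℕ.* y)} (S.trans (S.reflexive (cong const (⟪⟫-yes (zeroOne? d y) p))) const-1))
      (S.*-identityˡ (X ^ (a ℕ.* y)))

    term-¬zeroOne : ∀ y → ¬ ZeroOne d y → term d a y ≈ 0ˢ
    term-¬zeroOne y p = S.trans (S.*-congʳ {X ^ (a ℕ.* y)} (S.trans (S.reflexive (cong const (⟪⟫-no (zeroOne? d y) p))) const-0))
      (S.zeroˡ (X ^ (a ℕ.* y)))

    term-+ : ∀ y → term d a (d ℕ.+ y) ≈ X ^ (d ℕ.* a) ⊛ term d a y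
    term-+ y = begin
      const ⟪ zeroOne? d (d ℕ.+ y) ⟫ ⊛ X ^ (a ℕ.* (d ℕ.+ y))
        ≈⟨ S.*-cong
             (S.reflexive (cong const (⟪⟫-cong (zeroOne? d (d ℕ.+ y)) (zeroOne? d y) (zeroOne-+⁻ y) (zeroOne-+⁺ y))))
             (S.trans (S.reflexive (cong (X ^_) (trans (ℕ.*-distribˡ-+ a d y) (cong (ℕ._+ a ℕ.* y) (ℕ.*-comm a d)))))
               (S.^-homo-* X (d ℕ.* a) (a ℕ.* y))) ⟩
      const ⟪ zeroOne? d y ⟫ ⊛ (X ^ (d ℕ.* a) ⊛ X ^ (a ℕ.* y))
        ≈⟨ solve 3 (λ c x z → c :* (x :* z) := x :* (c :* z)) S.refl (const ⟪ zeroOne? d y ⟫) (X ^ (d ℕ.* a)) (X ^ (a ℕ.* y)) ⟩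
      X ^ (d ℕ.* a) ⊛ term d a y ∎
      where
      open ≈-Reasoning
      open S.Solver

    truncated-+ : ∀ b → truncated d a (d ℕ.+ b) ≈ (1ˢ ⊕ X ^ a) ⊕ X ^ (d ℕ.* a) ⊛ truncated d a b
    truncated-+ b = begin
      truncated d a (d ℕ.+ b)
        ≈⟨ pointwise (λ n → ∑-upTo-+ d b (λ y → term d a y n)) ⟩
      truncated d a d ⊕ ∑ˢ (upTo b) (λ y → term d a (d ℕ.+ y))
        ≈⟨ S.+-cong first-period (S.trans (∑ˢ-cong (upTo b) term-+) (S.sym (∑ˢ-⊛ˡ (upTo b) (X ^ (d ℕ.* a)) (term d a)))) ⟩
      (1ˢ ⊕ X ^ a) ⊕ X ^ (d ℕ.* a) ⊛ truncated d a b ∎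
      where
      open ≈-Reasoning
      first-period : truncated d a d ≈ 1ˢ ⊕ X ^ a
      first-period = begin
        truncated d a d
          -- A period consists of the residues 0 and 1, distinct because d ≥ 2, and d′ further
          -- residues whose terms are zero.
          ≈⟨ pointwise (λ n → ∑-upTo-+ 2 d′ (λ y → term d a y n)) ⟩
        truncated d a 2 ⊕ ∑ˢ (upTo d′) (λ y → term d a (2 ℕ.+ y))
          ≈⟨ S.+-cong (S.+-cong
               (S.trans (term-zeroOne 0 (inj₁ (d ∣0))) (S.reflexive (cong (X ^_) (ℕ.*-zeroʳ a))))
               (S.trans (S.+-identityʳ (term d a 1)) (S.trans (term-zeroOne 1 (inj₂ (d ∣0))) (S.reflexive (cong (X ^_) (ℕ.*-identityʳ a))))))
               (pointwise λ n → trans (∑-cong-∈ (upTo d′) (λ {y} y∈ → at (term-¬zeroOne (2 ℕ.+ y) (¬zeroOne y (∈-upTo⁻ y∈))) n))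
                 (∑-0 (upTo d′))) ⟩
        1ˢ ⊕ X ^ a ⊕ 0ˢ
          ≈⟨ S.+-identityʳ (1ˢ ⊕ X ^ a) ⟩
        1ˢ ⊕ X ^ a ∎

    module _ (0<a : 0 ℕ.< a) where
      -- Since a ≥ 1, each added term t^(ay) has y ≥ b and hence degree at least b.
      truncated-stable : ∀ b k → k ℕ.< b → truncated d a (d ℕ.+ b) k ≡ truncated d a b k
      truncated-stable b k k<b = begin
        truncated d a (d ℕ.+ b) k
          ≡⟨ cong (λ m → truncated d a m k) (ℕ.+-comm d b) ⟩
        truncated d a (b ℕ.+ d) k
          ≡⟨ ∑-upTo-+ b d (λ y → term d a y k) ⟩
        truncated d a b k + (∑[ y ← upTo d ] term d a (b ℕ.+ y) k)
          ≡⟨ cong (λ z → truncated d a b k + z) (trans (∑-cong (upTo d) vanishes) (∑-0 (upTo d))) ⟩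
        truncated d a b k + 0ℚ
          ≡⟨ ℚ.+-identityʳ (truncated d a b k) ⟩
        truncated d a b k ∎
        where
        open ≡-Reasoning
        vanishes : ∀ y → term d a (b ℕ.+ y) k ≡ 0ℚ
        vanishes y = trans (⊛-comm (const ⟪ zeroOne? d (b ℕ.+ y) ⟫) (X ^ (a ℕ.* (b ℕ.+ y))) k)
          (X^-⊛-< (a ℕ.* (b ℕ.+ y)) (const ⟪ zeroOne? d (b ℕ.+ y) ⟫)
            (ℕ.<-≤-trans k<b (ℕ.≤-trans (ℕ.m≤m+n b y) (ℕ.m≤n*m (b ℕ.+ y) a {{ℕ.>-nonZero 0<a}}))))

      -- Raising y by d multiplies a term by t^(da), so T = 1 + t^a + t^(da) T in degrees below b.
      -- Multiplication by G M = 1 / (1 - t^(da)) solves this for T.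
      truncated-coefficient : ∀ N D .{{_ : NonZero D}} → d ℕ.* a ℕ.* N ≡ D → ∀ b k → k ℕ.< b →
        truncated d a b k ≡ ((1ˢ ⊕ X ^ a) ⊛ (∑ˢ (upTo N) (λ j → X ^ (d ℕ.* a ℕ.* j)) ⊛ multiples D)) k
      truncated-coefficient N D daN≡D b k k<b = begin
        T k
          ≡⟨ at (S.*-identityˡ T) k ⟨
        (1ˢ ⊛ T) k
          ≡⟨ at (S.*-congʳ {T} inverse) k ⟨
        ((1ˢ ⊕ ⊖ X ^ (d ℕ.* a)) ⊛ G ⊛ M ⊛ T) k
          ≡⟨ at (solve 4 (λ v g m t → v :* g :* m :* t := v :* t :* (g :* m)) S.refl (1ˢ ⊕ ⊖ X ^ (d ℕ.* a)) G M T) k ⟩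
        ((1ˢ ⊕ ⊖ X ^ (d ℕ.* a)) ⊛ T ⊛ (G ⊛ M)) k
          -- The equation for T holds only below degree b, which suffices for coefficient k < b of
          -- the product.
          ≡⟨ ⊛-local {g = G ⊛ M} k (λ l l≤k → low l (ℕ.≤-<-trans l≤k k<b)) (λ _ _ → refl) ⟩
        ((1ˢ ⊕ X ^ a) ⊛ (G ⊛ M)) k ∎
        where
        open ≡-Reasoning
        open S.Solver
        T = truncated d a b
        G = ∑ˢ (upTo N) (λ j → X ^ (d ℕ.* a ℕ.* j))
        M = multiples D
        inverse : (1ˢ ⊕ ⊖ X ^ (d ℕ.* a)) ⊛ G ⊛ M ≈ 1ˢ
        inverse = S.trans (S.*-congʳ {M} (S.trans (geometric-sum X^-isExponential (d ℕ.* a) N)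
          (S.+-congˡ {1ˢ} (S.-‿cong (S.reflexive (cong (X ^_) daN≡D)))))) ([1-X^D]-⊛-multiples D)
        low : ∀ l → l ℕ.< b → ((1ˢ ⊕ ⊖ X ^ (d ℕ.* a)) ⊛ T) l ≡ (1ˢ ⊕ X ^ a) l
        low l l<b = begin
          ((1ˢ ⊕ ⊖ X ^ (d ℕ.* a)) ⊛ T) l
            ≡⟨ at (solve 3 (λ o x t → (o :- x) :* t := o :* t :- x :* t) S.refl 1ˢ (X ^ (d ℕ.* a)) T) l ⟩
          (1ˢ ⊛ T) l - (X ^ (d ℕ.* a) ⊛ T) l
            ≡⟨ cong (_- (X ^ (d ℕ.* a) ⊛ T) l) (trans (⊛-identityˡ T l)
                 (trans (sym (truncated-stable b l l<b)) (at (truncated-+ b) l))) ⟩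
          (1ˢ ⊕ X ^ a) l + (X ^ (d ℕ.* a) ⊛ T) l - (X ^ (d ℕ.* a) ⊛ T) l
            ≡⟨ x+y-y≡x ((1ˢ ⊕ X ^ a) l) ((X ^ (d ℕ.* a) ⊛ T) l) ⟩
          (1ˢ ⊕ X ^ a) l ∎
          where
          x+y-y≡x : ∀ x y → x + y - y ≡ x
          x+y-y≡x x y = trans (ℚ.+-assoc x y (- y)) (trans (cong (λ z → x + z) (ℚ.+-inverseʳ y)) (ℚ.+-identityʳ x))

∙-< : ∀ {s D} (a x : Vec ℕ (suc s)) → (∀ i → lookup a i ℕ.* lookup x i ℕ.< D) → a ∙ x ℕ.< suc s ℕ.* D
∙-< {zero}  (a ∷ []) (x ∷ []) p = ℕ.+-monoˡ-< 0 (p zero)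
∙-< {suc s} (a ∷ as) (x ∷ xs) p = ℕ.+-mono-< (p zero) (∙-< as xs (p ∘ suc))

module _ {r d′ : ℕ} (a : Vec ℕ r) (0<d : 0 ℕ.< 2 ℕ.+ d′) (0<a : ∀ i → 0 ℕ.< lookup a i) where
  private
    d = 2 ℕ.+ d′
  open RestrictedPartition d a 0<d 0<a

  -- Each coordinate contributes less than d aᵢ (jᵢ + 1) ≤ D, because εᵢ < 2 ≤ d. The strict total
  -- bound needs r > 0; it is what makes the terms of weight above n vanish in
  -- `X^-multiples-coefficient`.
  weight-< : ∀ k → r ≡ suc k → ∀ {ε j} → ε ∈ box (replicate r 2) → j ∈ box jBound → weight ε j ℕ.< r ℕ.* D
  weight-< k refl {ε} {j} ε∈ j∈ = ∙-< a (zipWith (λ jᵢ εᵢ → d ℕ.* jᵢ ℕ.+ εᵢ) j ε) λ i → begin-strict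
    lookup a i ℕ.* lookup (zipWith (λ jᵢ εᵢ → d ℕ.* jᵢ ℕ.+ εᵢ) j ε) i
      ≡⟨ a*[dj+ε] d a 0<d 0<a ε j i ⟩
    lookup a i ℕ.* lookup ε i ℕ.+ d ℕ.* lookup a i ℕ.* lookup j i
      <⟨ ℕ.+-monoˡ-< (d ℕ.* lookup a i ℕ.* lookup j i) (aε<da i) ⟩
    d ℕ.* lookup a i ℕ.+ d ℕ.* lookup a i ℕ.* lookup j i
      ≡⟨ ℕ.*-suc (d ℕ.* lookup a i) (lookup j i) ⟨
    d ℕ.* lookup a i ℕ.* suc (lookup j i)
      ≤⟨ ℕ.*-monoʳ-≤ (d ℕ.* lookup a i) (Pointwise.lookup (∈-box⁻ j∈) i) ⟩
    d ℕ.* lookup a i ℕ.* lookup jBound i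
      ≡⟨ da*jBound d a 0<d 0<a i ⟩
    D ∎
    where
    open ℕ.≤-Reasoning
    aε<da : ∀ i → lookup a i ℕ.* lookup ε i ℕ.< d ℕ.* lookup a i
    aε<da i = subst (lookup a i ℕ.* lookup ε i ℕ.<_) (ℕ.*-comm (lookup a i) d)
      (ℕ.*-monoʳ-< (lookup a i) {{ℕ.>-nonZero (0<a i)}}
        (ℕ.<-≤-trans (subst (lookup ε i ℕ.<_) (lookup-replicate i 2) (Pointwise.lookup (∈-box⁻ ε∈) i)) (s≤s (s≤s z≤n))))

  p-as-coefficient : ∀ n → fromℕ (p n) ≡ S.prod (λ i → truncated d (lookup a i) (suc n)) n
  p-as-coefficient n = begin
    fromℕ (p n)
      ≡⟨ fromℕ-length (solutions n) ⟩
    (∑[ _ ← solutions n ] 1ℚ)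
      ≡⟨ ∑-filter (admissible? n) B (λ _ → 1ℚ) ⟩
    (∑[ x ← B ] (⟪ admissible? n x ⟫ * 1ℚ))
      ≡⟨ ∑-cong B (λ x → trans (ℚ.*-identityʳ ⟪ admissible? n x ⟫) (indicator x)) ⟩
    ∑ˢ B (λ x → S.prod (λ i → term d (lookup a i) (lookup x i))) n
      ≡⟨ at (∑ˢ-box (replicate r (suc n)) (λ i → term d (lookup a i))) n ⟩
    S.prod (λ i → ∑ˢ (upTo (lookup (replicate r (suc n)) i)) (term d (lookup a i))) n
      ≡⟨ at (S.prod-cong (λ i → S.reflexive (cong (truncated d (lookup a i)) (lookup-replicate i (suc n))))) n ⟩
    S.prod (λ i → truncated d (lookup a i) (suc n)) n ∎
    where
    open ≡-Reasoning
    B = box (replicate r (suc n))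
    indicator : ∀ x → ⟪ admissible? n x ⟫ ≡ S.prod (λ i → term d (lookup a i) (lookup x i)) n
    indicator x = begin
      ⟪ admissible? n x ⟫
        ≡⟨ ⟪⟫-× (all? (zeroOne? d) x) ((a ∙ x) ℕ.≟ n) (admissible? n x) (λ (p , q) → q , p) (λ q p → p , q) ⟩
      ⟪ all? (zeroOne? d) x ⟫ * ⟪ (a ∙ x) ℕ.≟ n ⟫
        ≡⟨ cong (⟪ all? (zeroOne? d) x ⟫ *_) (X^-coefficient (a ∙ x) n) ⟨
      ⟪ all? (zeroOne? d) x ⟫ * (X ^ (a ∙ x)) n
        ≡⟨ const-⊛ ⟪ all? (zeroOne? d) x ⟫ (X ^ (a ∙ x)) n ⟨
      (const ⟪ all? (zeroOne? d) x ⟫ ⊛ X ^ (a ∙ x)) n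
        ≡⟨ at (S.*-cong (S.sym (prod-const-⟪⟫ (zeroOne? d) x)) (φ-∙ X^-isExponential a x)) n ⟩
      (S.prod (λ i → const ⟪ zeroOne? d (lookup x i) ⟫) ⊛ S.prod (λ i → X ^ (lookup a i ℕ.* lookup x i))) n
        ≡⟨ at (S.prod-distrib-* (λ i → const ⟪ zeroOne? d (lookup x i) ⟫) (λ i → X ^ (lookup a i ℕ.* lookup x i))) n ⟨
      S.prod (λ i → term d (lookup a i) (lookup x i)) n ∎

  partition-formula : ∀ k → r ≡ suc k → ∀ n → fromℕ (p n) ≡
    (1ℚ ÷ℕ k !) {{k !≢0}} *
    (∑[ ε ← box (replicate r 2) ]
     ∑[ j ← filter (λ j → weight ε j ≡? n [mod D ]) (box jBound) ]
     ∏[ ℓ ← applyUpTo suc k ] ((((fromℕ n - fromℕ (weight ε j)) ÷ℕ D) {{D≢0}}) + fromℕ ℓ))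
  partition-formula k refl n = begin
    fromℕ (p n)
      ≡⟨ p-as-coefficient n ⟩
    S.prod (λ i → truncated d (lookup a i) (suc n)) n
      -- Coefficient n of the product sees each factor only up to degree n, where the cut at n + 1
      -- makes no difference.
      ≡⟨ prod-local (λ i → truncated d (lookup a i) (suc n)) factors n
           (λ i l l≤n → truncated-coefficient d′ (lookup a i) (0<a i) (lookup jBound i) D (da*jBound d a 0<d 0<a i) (suc n) l (s≤s l≤n)) n ℕ.≤-refl ⟩
    S.prod factors n
      ≡⟨ at (prod-factors d a 0<d 0<a X^-isExponential jBound (multiples D)) n ⟩
    (∑[ ε ← box (replicate r 2) ] ∑[ j ← box jBound ] (X ^ weight ε j ⊛ multiples D ^ r) n)
      -- Membership in the two boxes is retained because the weight bound holds only there.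
      ≡⟨ ∑-cong-∈ (box (replicate r 2)) (λ {ε} ε∈ → ∑-cong-∈ (box jBound) (λ {j} j∈ →
           X^-multiples-coefficient D (weight ε j) n k (weight-< k refl ε∈ j∈))) ⟩
    (∑[ ε ← box (replicate r 2) ] ∑[ j ← box jBound ] (c * (⟪ weight ε j ≡? n [mod D ] ⟫ * Π ε j)))
      ≡⟨ ∑-cong (box (replicate r 2)) (λ ε → trans (sym (∑-distribˡ c (box jBound) (λ j → ⟪ weight ε j ≡? n [mod D ] ⟫ * Π ε j)))
           (cong (c *_) (sym (∑-filter (λ j → weight ε j ≡? n [mod D ]) (box jBound) (Π ε))))) ⟩
    (∑[ ε ← box (replicate r 2) ] (c * ∑ (filter (λ j → weight ε j ≡? n [mod D ]) (box jBound)) (Π ε)))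
      ≡⟨ ∑-distribˡ c (box (replicate r 2)) (λ ε → ∑ (filter (λ j → weight ε j ≡? n [mod D ]) (box jBound)) (Π ε)) ⟨
    c * (∑[ ε ← box (replicate r 2) ] ∑ (filter (λ j → weight ε j ≡? n [mod D ]) (box jBound)) (Π ε)) ∎
    where
    instance
      _ = D≢0
      _ = k !≢0
    open ≡-Reasoning
    c = 1ℚ ÷ℕ k !
    Π : Vec ℕ r → Vec ℕ r → ℚ
    Π ε j = ∏[ ℓ ← applyUpTo suc k ] ((fromℕ n - fromℕ (weight ε j)) ÷ℕ D + fromℕ ℓ)
    factors : Fin r → Series
    factors i = (1ˢ ⊕ X ^ lookup a i) ⊛ (∑ˢ (upTo (lookup jBound i)) (λ j → X ^ (d ℕ.* lookup a i ℕ.* j)) ⊛ multiples D)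

theorem2p3 : (r d : ℕ) → 2 ℕ.≤ r → (2≤d : 2 ℕ.≤ d) →
  (a : Vec ℕ r) → (0<a : ∀ i → 0 ℕ.< lookup a i) →
  let open RestrictedPartition d a (<⇒≤ 2≤d) 0<a
      instance
        _ = D≢0
        _ = (r ∸ 1) !≢0
        _ = m*n≢0 D ((r ∸ 1) !) {{D≢0}} {{(r ∸ 1) !≢0}}
  in
  ((n : ℕ) →
    fromℕ (p n) ≡
      (1ℚ ÷ℕ (r ∸ 1) !) *
      (∑[ ε ← box (replicate r 2) ]
       ∑[ j ← filter (λ j → weight ε j ≡? n [mod D ]) (box jBound) ]
       ∏[ ℓ ← applyUpTo ℕ.suc (r ∸ 1) ]
         ((fromℕ n - fromℕ (weight ε j)) ÷ℕ D + fromℕ ℓ)))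
  ×
  ((x : ℚ) →
    P x ≡
      (1ℚ ÷ℕ (D ℕ.* (r ∸ 1) !)) *
      (∑[ ε ← box (replicate r 2) ]
       ∑[ j ← box jBound ]
       ∏[ ℓ ← applyUpTo ℕ.suc (r ∸ 1) ]
         ((x - fromℕ (weight ε j)) ÷ℕ D + fromℕ ℓ)))
theorem2p3 (suc k) 0             _ ()
theorem2p3 (suc k) 1             _ (s≤s ())
theorem2p3 (suc k) (suc (suc _)) _ 2≤d a 0<a =
  partition-formula a (<⇒≤ 2≤d) 0<a k refl , polynomial-part _ a (<⇒≤ 2≤d) 0<a k refl
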